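{- Let $u,v$ be packed words of length $n$. Then $$\mathbf{N}_u*(\sigma_1^t)_n*\mathbf{N}_v=\sum_{w\in W(u,v)}\ \prod_{i=1}^{\max(u)}\binom{t+\max(w^{(i)})-a_0(v^{(i)},w^{(i)})}{\max(w^{(i)})}\ \mathbf{N}_w,$$ where $W(u,v)$ is the set of packed words $w$ of length $n$ which are finer than $u$ and weakly finer than $v$, and $v^{(i)}$, $w^{(i)}$ are the packed words of the subwords of $v$ and $w$ formed by the letters at the positions of the letter $i$ in $u$.
   Context: $\mathbb{K}$ is a field of characteristic $0$, $t$ an indeterminate, and $\binom{t+c}{m}=\frac{(t+c)(t+c-1)\cdots(t+c-m+1)}{m!}$. A word over the positive integers is packed if its set of letters is $\{1,\dots,r\}$ for some $r$; then $r=\max(u)$. For a word $w$ over a totally ordered alphabet with distinct letters $b_1<\dots<b_r$, $\mathrm{pack}(w)$ is obtained by replacing each $b_i$ by $i$. A packed word $u=u_1\cdots u_n$ is identified with the set composition of $\{1,\dots,n\}$ whose $i$-th block is $\{j:u_j=i\}$. For packed words of length $n$: $w$ is finer than $u$, $w\ge u$, if the set composition $u$ is obtained from $w$ by merging some consecutive blocks (equivalently $w_i\le w_j\Rightarrow u_i\le u_j$ for all $i,j$); $w$ is weakly finer than $v$, $w\in\mathrm{WRef}(v)$, if $w_i=w_j\Rightarrow v_i=v_j$ for all $i,j$. For packed words $v,w$ of the same length with $w\in\mathrm{WRef}(v)$, $u_0(v,w)$ is the set composition obtained from $w$ by merging two consecutive blocks $p',p''$ whenever the blocks of $v$ containing (the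 elements of) $p'$ are strictly to the left of those containing (the elements of) $p''$ (i.e. $v_i<v_j$ for all $i\in p'$, $j\in p''$), and iterating until no further blocks can be merged; $a_0(v,w)=\max(u_0(v,w))$ is its number of blocks. $\mathbf{WQSym}^*_n$ is the $\mathbb{K}$-vector space with basis $\mathbf{N}_u$, $u$ running over packed words of length $n$, with (associative) internal product $\mathbf{N}_u*\mathbf{N}_v=\mathbf{N}_{\mathrm{pack}\binom{u}{v}}$, where $\binom{u}{v}$ is the word of biletters $\binom{u_1}{v_1}\cdots\binom{u_n}{v_n}$, ordered lexicographically with priority to the top letter; scalars are extended to $\mathbb{K}[t]$. The degree $n$ component of $\sigma_1^t$ is $(\sigma_1^t)_n=\sum_{|u|=n}\binom{t}{\max(u)}\mathbf{N}_u$, the sum being over all packed words of length $n$. -}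

module Defs where

open import Algebra.Bundles using (CommutativeRing)
import Algebra.Definitions.RawMonoid as RawMonoidDefs
open import Data.Bool.Base using (true; false)
open import Data.Fin.Base using (Fin; zero; suc; toℕ; fromℕ<; punchOut)
open import Data.Fin.Properties
  using (all?; any?; injective⇒≤; punchOut-injective; toℕ-injective; toℕ<n; toℕ-fromℕ<;
         fromℕ<-injective)
import Data.Fin.Properties as Fin
open import Data.List.Base as List using (List; []; _∷_; length; filter; deduplicate)
import Data.List.Membership.Propositional as ∈ˡ
import Data.List.Membership.Propositional.Properties as ∈ˡ
import Data.List.Properties as List
open import Data.List.Relation.Unary.All as All using (All; []; _∷_)
open import Data.List.Relation.Unary.AllPairs as AllPairs using (AllPairs; []; _∷_)
open import Data.List.Relation.Unary.Any as Any using (Any; here; there)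
import Data.List.Relation.Unary.Any.Properties as Any
open import Data.List.Relation.Unary.Unique.DecSetoid.Properties using (deduplicate-!)
open import Data.List.Relation.Unary.Unique.Propositional using (Unique)
import Data.List.Relation.Unary.Unique.Propositional.Properties as Unique
open import Data.Nat.Base
  using (ℕ; zero; suc; pred; _∸_; _⊔_; _!; _≤_; _<_; z≤n; s≤s; s≤s⁻¹; NonZero)
open import Data.Nat.Properties hiding (_≟_; _<?_; _≤?_)
import Data.Nat.Properties as ℕ
open import Data.Product.Base using (_×_; _,_; proj₁; proj₂; ∃-syntax)
open import Data.Product.Relation.Binary.Lex.Strict using (×-strictTotalOrder)
open import Data.Vec.Base as Vec using (Vec; []; _∷_; lookup; zip; toList; count)
open import Data.Vec.Membership.Propositional using (_∈_)
import Data.Vec.Membership.Propositional.Properties as ∈ᵛ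
import Data.Vec.Properties as Vec
import Data.Vec.Relation.Unary.All as VAll
import Data.Vec.Relation.Unary.All.Properties as VAll
import Data.Vec.Relation.Unary.Any as VAny
import Data.Vec.Relation.Unary.Any.Properties as VAny
open import Function.Base using (_∘_)
open import Function.Bundles using (_⇔_; mk⇔; Equivalence)
open import Function.Definitions using (Injective)
open import Level using () renaming (_⊔_ to _⊔ˡ_; suc to lsuc)
open import Relation.Binary.Bundles using (StrictTotalOrder)
open import Relation.Binary.Construct.Closure.ReflexiveTransitive using (Star; ε; _◅_)
open import Relation.Binary.Definitions using (tri<; tri≈; tri>)
open import Relation.Binary.PropositionalEquality
  using (_≡_; _≢_; refl; sym; trans; cong; subst)
open import Relation.Nullary using (¬_; Dec; yes; no; does; contradiction)
open import Relation.Nullary.Decidable using (map′; _×-dec_; _→-dec_)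

Word : ℕ → Set
Word n = Vec ℕ n

max : ∀ {n} → Word n → ℕ
max []      = 0
max (x ∷ w) = x ⊔ max w

Packed : ∀ {n} → Word n → Set
Packed w = ∃[ r ] ∀ k → k ∈ w ⇔ (1 ≤ k × k ≤ r)

record PackedWord (n : ℕ) : Set where
  constructor mkPacked
  field
    word   : Word n
    packed : Packed word

open PackedWord public

∈⇒≤max : ∀ {n k} {w : Word n} → k ∈ w → k ≤ max w
∈⇒≤max {w = x ∷ w} (VAny.here refl) = m≤m⊔n x (max w)
∈⇒≤max {w = x ∷ w} (VAny.there k∈w) = ≤-trans (∈⇒≤max k∈w) (m≤n⊔m x (max w))

max-least : ∀ {n r} (w : Word n) → (∀ {k} → k ∈ w → k ≤ r) → max w ≤ r
max-least []      _ = z≤n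
max-least (x ∷ w) h = ⊔-lub (h (VAny.here refl)) (max-least w (h ∘ VAny.there))

lookup≤max : ∀ {n} (w : Word n) (i : Fin n) → lookup w i ≤ max w
lookup≤max w i = ∈⇒≤max (∈ᵛ.∈-lookup i w)

<max⇒∃ : ∀ {n j} (w : Word n) → j < max w → ∃[ i ] j < lookup w i
<max⇒∃ {j = j} w j<m with any? (λ i → j ℕ.<? lookup w i)
... | yes p = p
... | no ¬p = contradiction j<m (≤⇒≯ (max-least w λ k∈w →
  ≮⇒≥ λ j<k → ¬p (VAny.index k∈w , subst (j <_) (VAny.lookup-index k∈w) j<k)))

packed? : ∀ {n} (w : Word n) → Dec (Packed w)
packed? {n} w = map′ to from
  (VAll.all? (1 ℕ.≤?_) w ×-dec all? λ (k : Fin (max w)) → VAny.any? (suc (toℕ k) ℕ.≟_) w)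
  where
  to : VAll.All (1 ≤_) w × (∀ (k : Fin (max w)) → suc (toℕ k) ∈ w) → Packed w
  to (pos , hit) = max w , λ k → mk⇔
    (λ k∈w → VAll.lookup pos k∈w , ∈⇒≤max k∈w)
    λ { (s≤s _ , k≤m) → subst (λ z → suc z ∈ w) (toℕ-fromℕ< k≤m) (hit (fromℕ< k≤m)) }
  from : Packed w → VAll.All (1 ≤_) w × (∀ (k : Fin (max w)) → suc (toℕ k) ∈ w)
  from (r , h) =
    VAll.lookup⁻ (λ i → proj₁ (Equivalence.to (h _) (∈ᵛ.∈-lookup i w))) ,
    λ k → Equivalence.from (h _) (s≤s z≤n ,
      ≤-trans (toℕ<n k) (max-least w λ k∈w → proj₂ (Equivalence.to (h _) k∈w)))

-- words m n lists the words with letters in {1,…,m}; a packed word of length n has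
-- all its letters in {1,…,n}, see packedWords-complete.
words : ℕ → (n : ℕ) → List (Word n)
words m zero    = [] ∷ []
words m (suc n) = List.cartesianProductWith _∷_ (List.applyUpTo suc m) (words m n)

toPacked : ∀ {n} → List (Word n) → List (PackedWord n)
toPacked []       = []
toPacked (w ∷ ws) with packed? w
... | yes p = mkPacked w p ∷ toPacked ws
... | no  _ = toPacked ws

packedWords : (n : ℕ) → List (PackedWord n)
packedWords n = toPacked (words n n)

packed⇒max≤ : ∀ {n} {w : Word n} → Packed w → max w ≤ n
packed⇒max≤ {n} {w} (r , h) =
  ≤-trans (max-least w λ k∈w → proj₂ (Equivalence.to (h _) k∈w)) (injective⇒≤ {f = pos} pos-inj)
  where
  occ : (k : Fin r) → suc (toℕ k) ∈ w
  occ k = Equivalence.from (h _) (s≤s z≤n , toℕ<n k)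
  pos : Fin r → Fin n
  pos k = VAny.index (occ k)
  pos-inj : Injective _≡_ _≡_ pos
  pos-inj {j} {k} eq = toℕ-injective (suc-injective
    (trans (VAny.lookup-index (occ j))
      (trans (cong (lookup w) eq) (sym (VAny.lookup-index (occ k))))))

∈-words : ∀ {m n} (w : Word n) → (∀ {k} → k ∈ w → 1 ≤ k × k ≤ m) → w ∈ˡ.∈ words m n
∈-words []      _ = here refl
∈-words (x ∷ w) h with x | h (VAny.here refl)
... | suc _ | s≤s _ , x≤m = ∈ˡ.∈-cartesianProductWith⁺ _∷_
  (∈ˡ.∈-applyUpTo⁺ suc x≤m) (∈-words w (h ∘ VAny.there))

words-unique : ∀ m n → Unique (words m n)
words-unique m zero    = [] ∷ []
words-unique m (suc n) = Unique.cartesianProductWith⁺ _∷_ Vec.∷-injective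
  (Unique.applyUpTo⁺₁ suc m λ i<j _ → <⇒≢ (s≤s i<j)) (words-unique m n)

map-word-toPacked : ∀ {n} (ws : List (Word n)) →
                    List.map word (toPacked ws) ≡ filter packed? ws
map-word-toPacked []       = refl
map-word-toPacked (w ∷ ws) with packed? w
... | yes p = trans (cong (w ∷_) (map-word-toPacked ws)) (sym (List.filter-accept packed? p))
... | no ¬p = trans (map-word-toPacked ws) (sym (List.filter-reject packed? ¬p))

packedWords-complete : ∀ {n} (u : PackedWord n) →
                       word u ∈ˡ.∈ List.map word (packedWords n)
packedWords-complete {n} (mkPacked w p) =
  subst (w ∈ˡ.∈_) (sym (map-word-toPacked (words n n)))
    (∈ˡ.∈-filter⁺ packed?
      (∈-words w λ k∈w → proj₁ (Equivalence.to (proj₂ p _) k∈w) ,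
                         ≤-trans (∈⇒≤max k∈w) (packed⇒max≤ p)) p)

packedWords-unique : ∀ n → Unique (List.map word (packedWords n))
packedWords-unique n = subst Unique (sym (map-word-toPacked (words n n)))
  (Unique.filter⁺ packed? (words-unique n n))

length-filter-< : ∀ {a p q} {A : Set a} {P : A → Set p} {Q : A → Set q}
                  (P? : ∀ x → Dec (P x)) (Q? : ∀ x → Dec (Q x)) → (∀ {x} → P x → Q x) →
                  ∀ {xs} → Any (λ x → Q x × ¬ P x) xs →
                  length (filter P? xs) < length (filter Q? xs)
length-filter-< P? Q? P⇒Q = strict
  where
  mono : ∀ xs → length (filter P? xs) ≤ length (filter Q? xs)
  mono []       = z≤n
  mono (x ∷ xs) with P? x | Q? x
  ... | yes _ | yes _  = s≤s (mono xs)
  ... | yes p | no  ¬q = contradiction (P⇒Q p) ¬q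
  ... | no  _ | yes _  = m≤n⇒m≤1+n (mono xs)
  ... | no  _ | no  _  = mono xs
  strict : ∀ {xs} → Any _ xs → length (filter P? xs) < length (filter Q? xs)
  strict {x ∷ xs} (here (q , ¬p)) with P? x | Q? x
  ... | yes p | _      = contradiction p ¬p
  ... | no  _ | yes _  = s≤s (mono xs)
  ... | no  _ | no  ¬q = contradiction q ¬q
  strict {x ∷ xs} (there any) with P? x | Q? x
  ... | yes _ | yes _  = s≤s (strict any)
  ... | yes p | no  ¬q = contradiction (P⇒Q p) ¬q
  ... | no  _ | yes _  = m≤n⇒m≤1+n (strict any)
  ... | no  _ | no  _  = strict any

injective⇒surjective : ∀ {r} {f : Fin r → Fin r} → Injective _≡_ _≡_ f → ∀ k → ∃[ i ] f i ≡ k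
injective⇒surjective {suc r} {f} f-inj k with any? (λ i → f i Fin.≟ k)
... | yes p = p
... | no ¬p = contradiction
  (injective⇒≤ {f = λ i → punchOut (k≢f i)} λ {i} {j} → f-inj ∘ punchOut-injective (k≢f i) (k≢f j))
  1+n≰n
  where
  k≢f : ∀ i → k ≢ f i
  k≢f i k≡fi = ¬p (i , sym k≡fi)

module Packing {a ℓ₁ ℓ₂} (A : StrictTotalOrder a ℓ₁ ℓ₂) where

  open StrictTotalOrder A
    using (Carrier; _≈_; _≟_; _<?_; compare; decSetoid; module Eq)
    renaming (_<_ to _≺_; trans to ≺-trans; irrefl to ≺-irrefl;
              <-respˡ-≈ to ≺-respˡ-≈; <-respʳ-≈ to ≺-respʳ-≈)

  letters : ∀ {n} → Vec Carrier n → List Carrier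
  letters w = deduplicate _≟_ (toList w)

  -- The letter b is the i-th smallest of the distinct letters b₁ < … < b_r
  -- exactly when i - 1 of them are smaller than b.
  rank : ∀ {n} → Vec Carrier n → Carrier → ℕ
  rank w b = suc (length (filter (_<? b) (letters w)))

  packWord : ∀ {n} → Vec Carrier n → Word n
  packWord w = Vec.map (rank w) w

  module _ {n} (w : Vec Carrier n) where

    private
      r : ℕ
      r = length (letters w)

      bᵢ : Fin r → Carrier
      bᵢ = List.lookup (letters w)

    rank-mono : ∀ {x y} → Any (x ≈_) (letters w) → x ≺ y → rank w x < rank w y
    rank-mono {x} {y} x∈ x≺y = s≤s (length-filter-< (_<? x) (_<? y) (λ z≺x → ≺-trans z≺x x≺y)
      (Any.map (λ x≈z → ≺-respˡ-≈ x≈z x≺y , ≺-irrefl (Eq.sym x≈z)) x∈))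

    rank≤r : ∀ {x} → Any (x ≈_) (letters w) → rank w x ≤ r
    rank≤r {x} x∈ = List.filter-notAll (_<? x) (letters w) (Any.map (≺-irrefl ∘ Eq.sym) x∈)

    private
      bᵢ∈ : ∀ i → Any (bᵢ i ≈_) (letters w)
      bᵢ∈ i = Any.map Eq.reflexive (∈ˡ.∈-lookup i)

      lookup-inj : ∀ {xs} → AllPairs (λ x y → ¬ x ≈ y) xs →
                   ∀ i j → List.lookup xs i ≈ List.lookup xs j → i ≡ j
      lookup-inj (_ ∷ _)    zero    zero    _  = refl
      lookup-inj (x∉ ∷ _)   zero    (suc j) eq = contradiction eq (All.lookup x∉ (∈ˡ.∈-lookup j))
      lookup-inj (x∉ ∷ _)   (suc i) zero    eq =
        contradiction (Eq.sym eq) (All.lookup x∉ (∈ˡ.∈-lookup i))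
      lookup-inj (_ ∷ uniq) (suc i) (suc j) eq = cong suc (lookup-inj uniq i j eq)

      place : Fin r → Fin r
      place i = fromℕ< (rank≤r (bᵢ∈ i))

      place-inj : Injective _≡_ _≡_ place
      place-inj {i} {j} eq with compare (bᵢ i) (bᵢ j)
      ... | tri< lt _ _ = contradiction
              (cong suc (fromℕ<-injective _ _ _ _ eq)) (<⇒≢ (rank-mono (bᵢ∈ i) lt))
      ... | tri≈ _ e _  = lookup-inj (deduplicate-! decSetoid (toList w)) i j e
      ... | tri> _ _ gt = contradiction
              (sym (cong suc (fromℕ<-injective _ _ _ _ eq))) (<⇒≢ (rank-mono (bᵢ∈ j) gt))

      w⊆letters : ∀ {x} → x ∈ w → Any (x ≈_) (letters w)
      w⊆letters x∈w = Any.deduplicate⁺ _≟_ (λ z≈y x≈y → Eq.trans x≈y (Eq.sym z≈y))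
        (Any.map Eq.reflexive (∈ᵛ.∈-toList⁺ x∈w))

    packWord-packed : Packed (packWord w)
    packWord-packed = r , λ k → mk⇔ to from
      where
      to : ∀ {k} → k ∈ packWord w → 1 ≤ k × k ≤ r
      to k∈ with VAny.index k∈ | VAny.lookup-index k∈
      ... | i | refl rewrite Vec.lookup-map i (rank w) w =
        s≤s z≤n , rank≤r (w⊆letters (∈ᵛ.∈-lookup i w))
      from : ∀ {k} → 1 ≤ k × k ≤ r → k ∈ packWord w
      from (s≤s _ , k≤r) with injective⇒surjective place-inj (fromℕ< k≤r)
      ... | i , eq = subst (_∈ packWord w) (cong suc (fromℕ<-injective _ _ _ _ eq))
        (∈ᵛ.∈-map⁺ (rank w) (∈ᵛ.∈-toList⁻ (∈ˡ.∈-deduplicate⁻ _≟_ (toList w) (∈ˡ.∈-lookup i))))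

pack : ∀ {a ℓ₁ ℓ₂} (A : StrictTotalOrder a ℓ₁ ℓ₂) {n : ℕ} →
       Vec (StrictTotalOrder.Carrier A) n → PackedWord n
pack A w = mkPacked (Packing.packWord A w) (Packing.packWord-packed A w)

-- ×-strictTotalOrder is the lexicographic order, first component first.
packBiword : ∀ {n} → PackedWord n → PackedWord n → PackedWord n
packBiword u v =
  pack (×-strictTotalOrder <-strictTotalOrder <-strictTotalOrder) (zip (word u) (word v))

subword : ∀ {n} (u : Word n) (i : ℕ) → Word n → Word (count (ℕ._≟ i) u)
subword []      i []      = []
subword (x ∷ u) i (y ∷ v) with does (x ℕ.≟ i)
... | true  = y ∷ subword u i v
... | false = subword u i v

-- v ∣[ u ] i is v⁽ⁱ⁾: only the positions of the letter i in u are kept.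
infix 9 _∣[_]_
_∣[_]_ : ∀ {n} → PackedWord n → (u : PackedWord n) (i : ℕ) → PackedWord (count (ℕ._≟ i) (word u))
v ∣[ u ] i = pack <-strictTotalOrder (subword (word u) i (word v))

_FinerThan_ : ∀ {n} → PackedWord n → PackedWord n → Set
w FinerThan u = ∀ i j → lookup (word w) i ≤ lookup (word w) j → lookup (word u) i ≤ lookup (word u) j

_WeaklyFinerThan_ : ∀ {n} → PackedWord n → PackedWord n → Set
w WeaklyFinerThan v =
  ∀ i j → lookup (word w) i ≡ lookup (word w) j → lookup (word v) i ≡ lookup (word v) j

finerThan? : ∀ {n} (w u : PackedWord n) → Dec (w FinerThan u)
finerThan? w u = all? λ i → all? λ j → (_ ℕ.≤? _) →-dec (_ ℕ.≤? _)

weaklyFinerThan? : ∀ {n} (w v : PackedWord n) → Dec (w WeaklyFinerThan v)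
weaklyFinerThan? w v = all? λ i → all? λ j → (_ ℕ.≟ _) →-dec (_ ℕ.≟ _)

W : ∀ {n} → PackedWord n → PackedWord n → List (PackedWord n)
W {n} u v = filter (λ w → finerThan? w u ×-dec weaklyFinerThan? w v) (packedWords n)

-- The k-th block of w is { i : w_i = k }: the blocks of v containing it are strictly
-- to the left of those containing the (k+1)-st block of w.
Mergeable : ∀ {n} → Word n → Word n → ℕ → Set
Mergeable v w k = ∀ i j → lookup w i ≡ k → lookup w j ≡ suc k → lookup v i < lookup v j

mergeable? : ∀ {n} (v w : Word n) (k : ℕ) → Dec (Mergeable v w k)
mergeable? v w k =
  all? λ i → all? λ j → (_ ℕ.≟ k) →-dec ((_ ℕ.≟ suc k) →-dec (_ ℕ.<? _))

mergeLetter : ℕ → ℕ → ℕ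
mergeLetter k x with x ℕ.≤? k
... | yes _ = x
... | no  _ = pred x

merge : ∀ {n} → ℕ → Word n → Word n
merge k = Vec.map (mergeLetter k)

MergeStep : ∀ {n} → Word n → Word n → Word n → Set
MergeStep v w w′ = ∃[ k ] 1 ≤ k × k < max w × Mergeable v w k × w′ ≡ merge k w

Irreducible : ∀ {n} → Word n → Word n → Set
Irreducible v w = ∀ k → 1 ≤ k → k < max w → ¬ Mergeable v w k

-- The merges are performed from right to left.  By u₀-reachable and
-- u₀-irreducible below, a single such pass is an iteration of mergings that ends
-- when no further blocks can be merged.
mergeFrom : ∀ {n} → ℕ → Word n → Word n → Word n
mergeFrom zero    v w = w
mergeFrom (suc k) v w with mergeable? v w (suc k)
... | yes _ = mergeFrom k v (merge (suc k) w)
... | no  _ = mergeFrom k v w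

u₀ : ∀ {n} → Word n → Word n → Word n
u₀ v w = mergeFrom (max w ∸ 1) v w

a₀ : ∀ {n} → PackedWord n → PackedWord n → ℕ
a₀ v w = max (u₀ (word v) (word w))

private
  lookup-merge-≤ : ∀ {n} k (w : Word n) i → lookup w i ≤ k → lookup (merge k w) i ≡ lookup w i
  lookup-merge-≤ k w i le rewrite Vec.lookup-map i (mergeLetter k) w with lookup w i ℕ.≤? k
  ... | yes _ = refl
  ... | no ¬p = contradiction le ¬p

  lookup-merge-> : ∀ {n} k (w : Word n) i {x} → lookup w i ≡ suc x → k ≤ x → lookup (merge k w) i ≡ x
  lookup-merge-> k w i eq k≤x
    rewrite Vec.lookup-map i (mergeLetter k) w with lookup w i ℕ.≤? k
  ... | yes p = contradiction (≤-trans (≤-reflexive (sym eq)) p) (<⇒≱ (s≤s k≤x))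
  ... | no  _ = cong pred eq

  max-merge : ∀ {n k j} (w : Word n) → k ≤ suc j → suc j < max w → j < max (merge k w)
  max-merge {k = k} {j} w k≤j lt with <max⇒∃ w lt
  ... | i , lt′ with lookup w i in eq
  ... | suc x = ≤-trans (s≤s⁻¹ lt′) (≤-trans
    (≤-reflexive (sym (lookup-merge-> k w i eq (≤-trans k≤j (s≤s⁻¹ lt′)))))
    (lookup≤max (merge k w) i))

  max-merge⁻ : ∀ {n k j} (w : Word n) → k ≤ j → j < max (merge k w) → suc j < max w
  max-merge⁻ {k = k} {j} w k≤j lt with <max⇒∃ (merge k w) lt
  ... | i , lt′ with lookup w i ℕ.≤? k
  ... | yes p = contradiction (≤-trans lt′ (≤-trans (≤-reflexive (lookup-merge-≤ k w i p)) p))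
                              (≤⇒≯ k≤j)
  ... | no ¬p with lookup w i in eq
  ... | zero  = contradiction z≤n ¬p
  ... | suc x = ≤-trans (s≤s (subst (j <_) (lookup-merge-> k w i eq (s≤s⁻¹ (≰⇒> ¬p))) lt′))
                        (≤-trans (≤-reflexive (sym eq)) (lookup≤max w i))

  <⇒≤∸1 : ∀ {k m} → k < m → k ≤ m ∸ 1
  <⇒≤∸1 {m = suc m} (s≤s k≤m) = k≤m

  ≤∸1⇒< : ∀ {k m} → suc k ≤ m ∸ 1 → suc k < m
  ≤∸1⇒< {m = suc m} k<m = s≤s k<m

mergeFrom-reachable : ∀ {n} k (v w : Word n) → k ≤ max w ∸ 1 →
                      Star (MergeStep v) w (mergeFrom k v w)
mergeFrom-reachable zero    v w _  = ε
mergeFrom-reachable (suc k) v w le with mergeable? v w (suc k)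
... | no  _ = mergeFrom-reachable k v w (≤-trans (n≤1+n k) le)
... | yes m = (suc k , s≤s z≤n , ≤∸1⇒< le , m , refl) ◅
  mergeFrom-reachable k v (merge (suc k) w) (<⇒≤∸1 (max-merge w ≤-refl (≤∸1⇒< le)))

mergeFrom-irreducible : ∀ {n} k (v w : Word n) →
                        (∀ j → k < j → j < max w → ¬ Mergeable v w j) →
                        Irreducible v (mergeFrom k v w)
mergeFrom-irreducible zero    v w inv = inv
mergeFrom-irreducible (suc k) v w inv with mergeable? v w (suc k)
... | no ¬m = mergeFrom-irreducible k v w inv′
  where
  inv′ : ∀ j → k < j → j < max w → ¬ Mergeable v w j
  inv′ j k<j j<max with suc k ℕ.≟ j
  ... | yes refl = ¬m
  ... | no  ≢    = inv j (≤∧≢⇒< k<j ≢) j<max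
... | yes _ = mergeFrom-irreducible k v (merge (suc k) w) λ j k<j j<max m →
  inv (suc j) (s≤s k<j) (max-merge⁻ w k<j j<max) λ i i′ eq eq′ →
    m i i′ (lookup-merge-> (suc k) w i eq k<j)
           (lookup-merge-> (suc k) w i′ eq′ (m≤n⇒m≤1+n k<j))

u₀-reachable : ∀ {n} (v w : Word n) → Star (MergeStep v) w (u₀ v w)
u₀-reachable v w = mergeFrom-reachable (max w ∸ 1) v w ≤-refl

u₀-irreducible : ∀ {n} (v w : Word n) → Irreducible v (u₀ v w)
u₀-irreducible v w = mergeFrom-irreducible (max w ∸ 1) v w λ j lt j<max _ →
  contradiction (<⇒≤∸1 j<max) (<⇒≱ lt)

record Field c ℓ : Set (lsuc (c ⊔ˡ ℓ)) where
  field
    commutativeRing : CommutativeRing c ℓ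

  open CommutativeRing commutativeRing public

  field
    1≉0     : ¬ 1# ≈ 0#
    inverse : ∀ x → ¬ x ≈ 0# → ∃[ y ] x * y ≈ 1#

  open RawMonoidDefs +-rawMonoid public using () renaming (_×_ to _·_)

  ⟦_⟧ : ℕ → Carrier
  ⟦ m ⟧ = m · 1#

CharacteristicZero : ∀ {c ℓ} → Field c ℓ → Set ℓ
CharacteristicZero K = ∀ m → .{{_ : NonZero m}} → ¬ ⟦ m ⟧ ≈ 0#
  where open Field K

module WQSym {c ℓ} (K : Field c ℓ) (char0 : CharacteristicZero K) where

  open Field K using (Carrier; 0#; 1#; ⟦_⟧; inverse) renaming
    (_≈_ to _≈ᴷ_; _+_ to _+ᴷ_; _*_ to _*ᴷ_; _-_ to _-ᴷ_)

  -- The list a₀ ∷ a₁ ∷ … is the polynomial a₀ + a₁ t + …; trailing zeros are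
  -- allowed, so polynomials are compared by _≈ᴾ_.
  K[t] : Set c
  K[t] = List Carrier

  coeff : K[t] → ℕ → Carrier
  coeff []      _       = 0#
  coeff (a ∷ p) zero    = a
  coeff (a ∷ p) (suc k) = coeff p k

  infix 4 _≈ᴾ_
  _≈ᴾ_ : K[t] → K[t] → Set ℓ
  p ≈ᴾ q = ∀ k → coeff p k ≈ᴷ coeff q k

  0ᴾ 1ᴾ : K[t]
  0ᴾ = []
  1ᴾ = 1# ∷ []

  infixl 6 _+ᴾ_
  _+ᴾ_ : K[t] → K[t] → K[t]
  []      +ᴾ q       = q
  (a ∷ p) +ᴾ []      = a ∷ p
  (a ∷ p) +ᴾ (b ∷ q) = (a +ᴷ b) ∷ (p +ᴾ q)

  scale : Carrier → K[t] → K[t]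
  scale a = List.map (a *ᴷ_)

  infixl 7 _*ᴾ_
  _*ᴾ_ : K[t] → K[t] → K[t]
  []      *ᴾ q = []
  (a ∷ p) *ᴾ q = scale a q +ᴾ (0# ∷ (p *ᴾ q))

  ∏[1…_] : ℕ → (ℕ → K[t]) → K[t]
  ∏[1… zero  ] f = 1ᴾ
  ∏[1… suc r ] f = ∏[1… r ] f *ᴾ f (suc r)

  infixl 8 t+_
  t+_ : Carrier → K[t]
  t+ a = a ∷ 1# ∷ []

  _!⁻¹ : ℕ → Carrier
  m !⁻¹ = proj₁ (inverse ⟦ m ! ⟧ (char0 (m !) {{m !≢0}}))

  -- binomial c m is the polynomial (t+c choose m).
  binomial : Carrier → ℕ → K[t]
  binomial c m = scale (m !⁻¹) (∏[1… m ] λ i → t+ (c -ᴷ ⟦ i ∸ 1 ⟧))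

  -- Elements of the degree-n component, with scalars extended to K[t], as formal
  -- linear combinations Σ a N_u; they are equal when the total coefficients of every
  -- basis element agree.
  WQSym* : ℕ → Set c
  WQSym* n = List (K[t] × PackedWord n)

  coefficient : ∀ {n} → WQSym* n → PackedWord n → K[t]
  coefficient []            w = 0ᴾ
  coefficient ((a , u) ∷ x) w with Vec.≡-dec ℕ._≟_ (word u) (word w)
  ... | yes _ = a +ᴾ coefficient x w
  ... | no  _ = coefficient x w

  infix 4 _≋_
  _≋_ : ∀ {n} → WQSym* n → WQSym* n → Set ℓ
  x ≋ y = ∀ w → coefficient x w ≈ᴾ coefficient y w

  N : ∀ {n} → PackedWord n → WQSym* n
  N u = (1ᴾ , u) ∷ []

  infixr 8 _•_
  _•_ : ∀ {n} → K[t] → WQSym* n → WQSym* n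
  a • x = List.map (λ (b , u) → (a *ᴾ b) , u) x

  ∑ : ∀ {n} {A : Set} → List A → (A → WQSym* n) → WQSym* n
  ∑ xs f = List.concatMap f xs

  -- The bilinear extension of N_u * N_v = N_{pack (u over v)}.
  infixl 7 _⋆_
  _⋆_ : ∀ {n} → WQSym* n → WQSym* n → WQSym* n
  x ⋆ y = List.cartesianProductWith (λ (a , u) (b , v) → (a *ᴾ b) , packBiword u v) x y

  σ₁ᵗ : (n : ℕ) → WQSym* n
  σ₁ᵗ n = ∑ (packedWords n) λ u → binomial 0# (max (word u)) • N u

{-# OPTIONS --safe #-}

-- Two polynomials agreeing at every natural number are equal, so t may be specialised to
-- T ∈ ℕ.  Since binom(T, max x) is the number of words z over {1,…,T} with pack(z) = x,
-- the coefficient of N_w on the left counts the words z over {1,…,T} such that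
-- pack(u, z, v) = w.  There are none unless w ∈ W(u,v); otherwise the condition bears
-- separately on the subwords of z at the positions of each letter of u.  For one such
-- subword, z is a function of the letters of w which is weakly increasing between k and
-- k + 1 when the blocks k and k + 1 of w may be merged, and strictly increasing otherwise.
-- The number of mergeable k is max w - a₀, and the hockey-stick identity gives the count
-- binom(T + max w - a₀, max w).
module Submission where

open import Defs
import Algebra.Properties.CommutativeSemigroup
import Algebra.Properties.Group
import Algebra.Properties.Ring
import Algebra.Properties.Semiring.Mult
import Algebra.Solver.Ring.NaturalCoefficients.Default
open import Data.Bool.Base using (true; false)
open import Data.Fin.Base using (Fin; zero; suc)
open import Data.Fin.Properties using (all?; any?)
open import Data.List.Base as List
  using (List; []; _∷_; _++_; filter; length; applyUpTo; cartesianProductWith)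
open import Data.List.Membership.Propositional using () renaming (_∈_ to _∈ˡ_)
import Data.List.Membership.Propositional.Properties as ∈ˡ
import Data.List.Properties as List
open import Data.List.Relation.Unary.All as All using ()
open import Data.List.Relation.Unary.AllPairs using (_∷_)
open import Data.List.Relation.Unary.Any as Any using (Any; here; there)
import Data.List.Relation.Unary.Any.Properties as Any
open import Data.List.Relation.Unary.Unique.Propositional using (Unique)
open import Data.Nat.Base as ℕ using (ℕ; zero; suc; _∸_; _!; _≤_; s≤s; z≤n)
open import Data.Nat.Combinatorics using (_C_; nC1≡n; k>n⇒nCk≡0; nCk+nC[k+1]≡[n+1]C[k+1])
import Data.Nat.Properties as ℕ
import Data.Nat.Solver
open import Data.Product.Base using (_×_; _,_; proj₁; proj₂; ∃-syntax)
open import Data.Product.Relation.Binary.Lex.Strict using (×-strictTotalOrder)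
open import Data.Sum.Base using (_⊎_; inj₁; inj₂)
open import Data.Unit.Base using (⊤; tt)
open import Data.Vec.Base as Vec using (Vec; []; _∷_; lookup; count)
import Data.Vec.Membership.Propositional.Properties as ∈ᵛ
import Data.Vec.Properties as Vec
import Data.Vec.Relation.Unary.Any as VAny
import Data.Vec.Relation.Unary.Any.Properties as VAny
open import Function.Base using (_∘_; id)
open import Function.Bundles using (Equivalence)
import Level
open import Relation.Binary.Bundles using (StrictTotalOrder)
open import Relation.Binary.Definitions using (DecidableEquality; tri<; tri≈; tri>)
open import Relation.Binary.PropositionalEquality as ≡ using (_≡_; _≢_)
import Relation.Binary.Reasoning.Setoid
open import Relation.Nullary using (¬_; Dec; yes; no; does; proof; ofʸ; ofⁿ; contradiction)
open import Relation.Nullary.Decidable using (_×-dec_; _⊎-dec_; _→-dec_; map′)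

-- The obstacle is packing itself: it replaces letters by ranks, and ranks in an iterated packing
-- are awkward to compare. `Represents` avoids them. A packed word is determined by the strict
-- comparisons between its letters, so pack(u, z, v) = w says that `w` orders the positions as the
-- triples (u_i, z_i, v_i) are ordered lexicographically. This condition concerns pairs of
-- positions. Pairs with different letters in `u` are settled by `u` and the fineness of `w`, which
-- is why the count factors over the letters of `u`. For a pair with the same letter in `u` only (z,
-- v) matters: on two adjacent blocks of `w`, a tie of `z` is harmless exactly when `v` increases
-- from the first block to the second, and this is the condition for merging them. The difference
-- max w - a₀ enters as the natural number `#M` with a₀ + #M = max w. This equality holds because
-- merging two blocks neither creates nor destroys a possible merge further to the left.

module Counting where


  open import Data.Nat.Base hiding (compare)
  open import Data.Nat.Properties hiding (_≟_; _<?_; _≤?_)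
  open import Relation.Binary.PropositionalEquality
  open ≡-Reasoning
  open Algebra.Properties.CommutativeSemigroup *-commutativeSemigroup using (x∙yz≈y∙xz)

  -- Finite sums of natural numbers and indicators of decidable statements.

  private variable
    A B D : Set
    P Q : Set

  Sum : List A → (A → ℕ) → ℕ
  Sum []       F = 0
  Sum (x ∷ xs) F = F x + Sum xs F

  ind : Dec P → ℕ
  ind (yes _) = 1
  ind (no  _) = 0

  ind-yes : (p? : Dec P) → P → ind p? ≡ 1
  ind-yes (yes _) _ = refl
  ind-yes (no ¬p) p = contradiction p ¬p

  ind-no : (p? : Dec P) → ¬ P → ind p? ≡ 0
  ind-no (yes p) ¬p = contradiction p ¬p
  ind-no (no _)  _  = refl

  ind≤1 : ∀ {P : Set} (p? : Dec P) → ind p? ≤ 1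
  ind≤1 (yes _) = ≤-refl
  ind≤1 (no  _) = z≤n

  ind-cong : (p? : Dec P) (q? : Dec Q) → (P → Q) → (Q → P) → ind p? ≡ ind q?
  ind-cong (yes p) q? f g = sym (ind-yes q? (f p))
  ind-cong (no ¬p) q? f g = sym (ind-no q? (¬p ∘ g))

  ind-× : (p? : Dec P) (q? : Dec Q) → ind (p? ×-dec q?) ≡ ind p? * ind q?
  ind-× (yes _) (yes _) = refl
  ind-× (yes _) (no  _) = refl
  ind-× (no  _) _       = refl

  Sum-cong : ∀ (xs : List A) {F G : A → ℕ} → (∀ x → x ∈ˡ xs → F x ≡ G x) → Sum xs F ≡ Sum xs G
  Sum-cong []       eq = refl
  Sum-cong (x ∷ xs) eq = cong₂ _+_ (eq x (here refl)) (Sum-cong xs λ y y∈ → eq y (there y∈))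

  Sum-zero : ∀ (xs : List A) {F : A → ℕ} → (∀ x → x ∈ˡ xs → F x ≡ 0) → Sum xs F ≡ 0
  Sum-zero []       eq = refl
  Sum-zero (x ∷ xs) eq = cong₂ _+_ (eq x (here refl)) (Sum-zero xs λ y y∈ → eq y (there y∈))

  Sum-+ : ∀ (xs : List A) (F G : A → ℕ) → Sum xs (λ x → F x + G x) ≡ Sum xs F + Sum xs G
  Sum-+ []       F G = refl
  Sum-+ (x ∷ xs) F G = begin
    F x + G x + Sum xs (λ x → F x + G x)    ≡⟨ cong (F x + G x +_) (Sum-+ xs F G) ⟩
    F x + G x + (Sum xs F + Sum xs G)       ≡⟨ +-assoc (F x) (G x) _ ⟩
    F x + (G x + (Sum xs F + Sum xs G))     ≡⟨ cong (F x +_) (+-assoc (G x) _ _) ⟨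
    F x + (G x + Sum xs F + Sum xs G)       ≡⟨ cong (λ s → F x + (s + Sum xs G)) (+-comm (G x) _) ⟩
    F x + (Sum xs F + G x + Sum xs G)       ≡⟨ cong (F x +_) (+-assoc (Sum xs F) _ _) ⟩
    F x + (Sum xs F + (G x + Sum xs G))     ≡⟨ +-assoc (F x) _ _ ⟨
    F x + Sum xs F + (G x + Sum xs G)       ∎

  Sum-*ˡ : ∀ c (xs : List A) (F : A → ℕ) → Sum xs (λ x → c * F x) ≡ c * Sum xs F
  Sum-*ˡ c []       F = sym (*-zeroʳ c)
  Sum-*ˡ c (x ∷ xs) F = trans (cong (c * F x +_) (Sum-*ˡ c xs F)) (sym (*-distribˡ-+ c (F x) _))

  Sum-*ʳ : ∀ c (xs : List A) (F : A → ℕ) → Sum xs (λ x → F x * c) ≡ Sum xs F * c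
  Sum-*ʳ c xs F = begin
    Sum xs (λ x → F x * c)  ≡⟨ Sum-cong xs (λ x _ → *-comm (F x) c) ⟩
    Sum xs (λ x → c * F x)  ≡⟨ Sum-*ˡ c xs F ⟩
    c * Sum xs F            ≡⟨ *-comm c _ ⟩
    Sum xs F * c            ∎

  Sum-swap : ∀ (xs : List A) (ys : List B) (F : A → B → ℕ) →
             Sum xs (λ x → Sum ys (F x)) ≡ Sum ys (λ y → Sum xs (λ x → F x y))
  Sum-swap []       ys F = sym (Sum-zero ys λ _ _ → refl)
  Sum-swap (x ∷ xs) ys F =
    trans (cong (Sum ys (F x) +_) (Sum-swap xs ys F)) (sym (Sum-+ ys (F x) _))

  Sum-++ : ∀ (xs ys : List A) (F : A → ℕ) → Sum (xs ++ ys) F ≡ Sum xs F + Sum ys F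
  Sum-++ []       ys F = refl
  Sum-++ (x ∷ xs) ys F = trans (cong (F x +_) (Sum-++ xs ys F)) (sym (+-assoc (F x) _ _))

  Sum-map : ∀ (f : A → B) (xs : List A) (F : B → ℕ) → Sum (List.map f xs) F ≡ Sum xs (F ∘ f)
  Sum-map f []       F = refl
  Sum-map f (x ∷ xs) F = cong (F (f x) +_) (Sum-map f xs F)

  Sum-cartesianProductWith : ∀ (f : A → B → D) (xs : List A) (ys : List B) (F : D → ℕ) →
    Sum (cartesianProductWith f xs ys) F ≡ Sum xs (λ x → Sum ys (λ y → F (f x y)))
  Sum-cartesianProductWith f []       ys F = refl
  Sum-cartesianProductWith f (x ∷ xs) ys F =
    trans (Sum-++ (List.map (f x) ys) _ F)
      (cong₂ _+_ (Sum-map (f x) ys F) (Sum-cartesianProductWith f xs ys F))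

  Sum-filter : ∀ {P : A → Set} (P? : ∀ x → Dec (P x)) (xs : List A) (F : A → ℕ) →
               Sum (filter P? xs) F ≡ Sum xs (λ x → ind (P? x) * F x)
  Sum-filter P? []       F = refl
  Sum-filter P? (x ∷ xs) F with P? x
  ... | yes _ = cong₂ _+_ (sym (+-identityʳ (F x))) (Sum-filter P? xs F)
  ... | no  _ = Sum-filter P? xs F

  Sum-applyUpTo-∷ʳ : ∀ (f : ℕ → A) n (F : A → ℕ) →
                     Sum (applyUpTo f (suc n)) F ≡ Sum (applyUpTo f n) F + F (f n)
  Sum-applyUpTo-∷ʳ f n F = begin
    Sum (applyUpTo f (suc n)) F                ≡⟨ cong (λ xs → Sum xs F) (List.applyUpTo-∷ʳ f n) ⟨
    Sum (applyUpTo f n List.∷ʳ f n) F          ≡⟨ Sum-++ (applyUpTo f n) _ F ⟩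
    Sum (applyUpTo f n) F + (F (f n) + 0)      ≡⟨ cong (Sum (applyUpTo f n) F +_) (+-identityʳ _) ⟩
    Sum (applyUpTo f n) F + F (f n)            ∎

  module _ (_≟_ : DecidableEquality B) (key : A → B) where

    -- Comparison goes through `key` because packed words are identified by their `word` alone: two
    -- of them may carry different proofs of packedness.
    Sum-δ : ∀ (F : A → ℕ) {xs y} → Unique (List.map key xs) → y ∈ˡ xs →
            Sum xs (λ x → ind (key x ≟ key y) * F x) ≡ F y
    Sum-δ F {x ∷ xs} {y} (x∉ ∷ _) (here refl) = begin
      ind (key y ≟ key y) * F y + Sum xs _  ≡⟨ cong₂ _+_ (cong (_* F y) (ind-yes (key y ≟ key y) refl))
                                                          (Sum-zero xs rest) ⟩
      1 * F y + 0                           ≡⟨ trans (+-identityʳ _) (+-identityʳ _) ⟩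
      F y                                   ∎
      where
      rest : ∀ z → z ∈ˡ xs → ind (key z ≟ key y) * F z ≡ 0
      rest z z∈ = cong (_* F z) (ind-no (key z ≟ key y) λ eq →
        All.lookup x∉ (∈ˡ.∈-map⁺ key z∈) (sym eq))
    Sum-δ F {x ∷ xs} {y} (x∉ ∷ uniq) (there y∈) =
      cong₂ _+_ (cong (_* F x) (ind-no (key x ≟ key y) (All.lookup x∉ (∈ˡ.∈-map⁺ key y∈))))
                (Sum-δ F uniq y∈)

  Sum-δ-id : ∀ (_≟_ : DecidableEquality A) (F : A → ℕ) {xs y} → Unique xs → y ∈ˡ xs →
             Sum xs (λ x → ind (x ≟ y) * F x) ≡ F y
  Sum-δ-id _≟_ F {xs} uniq = Sum-δ _≟_ id F (subst Unique (sym (List.map-id xs)) uniq)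

  -- Inserts a sum over the graph of `φ`: each `x` with `P x` meets exactly one `y` of the
  -- duplicate-free `ys`. The resulting double sum can be transposed by `Sum-swap`.
  Sum-graph : ∀ {P : A → Set} {Q : B → Set} (_≟_ : DecidableEquality B)
              (P? : ∀ x → Dec (P x)) (Q? : ∀ y → Dec (Q y)) (φ : A → B) {xs ys} → Unique ys →
              (∀ x → x ∈ˡ xs → P x → φ x ∈ˡ ys × Q (φ x)) →
              Sum xs (λ x → ind (P? x)) ≡
              Sum xs (λ x → Sum ys λ y → ind (y ≟ φ x) * (ind (P? x) * ind (Q? y)))
  Sum-graph {P = P} _≟_ P? Q? φ {xs} {ys} uniq to = Sum-cong xs λ x x∈ → row x x∈ (P? x)
    where
    row : ∀ x → x ∈ˡ xs → (p? : Dec (P x)) →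
          ind p? ≡ Sum ys λ y → ind (y ≟ φ x) * (ind p? * ind (Q? y))
    row x x∈ (no ¬p) = sym (Sum-zero ys λ y _ → *-zeroʳ (ind (y ≟ φ x)))
    row x x∈ (yes p) = let φx∈ , q = to x x∈ p in begin
      1                   ≡⟨ ind-yes (Q? (φ x)) q ⟨
      ind (Q? (φ x))      ≡⟨ +-identityʳ _ ⟨
      1 * ind (Q? (φ x))  ≡⟨ Sum-δ-id _≟_ (λ y → 1 * ind (Q? y)) uniq φx∈ ⟨
      _                   ∎

  module _ {P : A → Set} {Q : B → Set} (_≟ᴬ_ : DecidableEquality A) (_≟ᴮ_ : DecidableEquality B)
           (P? : ∀ x → Dec (P x)) (Q? : ∀ y → Dec (Q y)) (φ : A → B) (ψ : B → A) where

    -- Double counting of one graph: on pairs satisfying `P` and `Q`, the graph of `φ` is the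
    -- transpose of that of `ψ`. The maps have to be inverse on such elements only; elsewhere their
    -- values are arbitrary.
    Sum-bijection : ∀ {xs ys} → Unique xs → Unique ys →
      (∀ x → x ∈ˡ xs → P x → φ x ∈ˡ ys × Q (φ x) × ψ (φ x) ≡ x) →
      (∀ y → y ∈ˡ ys → Q y → ψ y ∈ˡ xs × P (ψ y) × φ (ψ y) ≡ y) →
      Sum xs (λ x → ind (P? x)) ≡ Sum ys (λ y → ind (Q? y))
    Sum-bijection {xs} {ys} uxs uys to from = begin
      Sum xs (λ x → ind (P? x))
        ≡⟨ Sum-graph _≟ᴮ_ P? Q? φ uys (λ x x∈ p → let φ∈ , q , _ = to x x∈ p in φ∈ , q) ⟩
      Sum xs (λ x → Sum ys λ y → ind (y ≟ᴮ φ x) * (ind (P? x) * ind (Q? y)))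
        ≡⟨ Sum-swap xs ys _ ⟩
      Sum ys (λ y → Sum xs λ x → ind (y ≟ᴮ φ x) * (ind (P? x) * ind (Q? y)))
        ≡⟨ Sum-cong ys (λ y y∈ → Sum-cong xs λ x x∈ → flip-graph x∈ y∈) ⟩
      Sum ys (λ y → Sum xs λ x → ind (x ≟ᴬ ψ y) * (ind (Q? y) * ind (P? x)))
        ≡⟨ Sum-graph _≟ᴬ_ Q? P? ψ uxs (λ y y∈ q → let ψ∈ , p , _ = from y y∈ q in ψ∈ , p) ⟨
      Sum ys (λ y → ind (Q? y))
        ∎
      where
      flip-graph : ∀ {x y} → x ∈ˡ xs → y ∈ˡ ys →
                   ind (y ≟ᴮ φ x) * (ind (P? x) * ind (Q? y)) ≡
                   ind (x ≟ᴬ ψ y) * (ind (Q? y) * ind (P? x))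
      flip-graph {x} {y} x∈ y∈ = begin
        ind (y ≟ᴮ φ x) * (ind (P? x) * ind (Q? y))    ≡⟨ merge-ind (y ≟ᴮ φ x) (P? x) (Q? y) ⟩
        ind ((y ≟ᴮ φ x) ×-dec (P? x ×-dec Q? y))      ≡⟨ ind-cong _ _
          (λ { (refl , p , q) → sym (proj₂ (proj₂ (to x x∈ p))) , q , p })
          (λ { (refl , q , p) → sym (proj₂ (proj₂ (from y y∈ q))) , p , q }) ⟩
        ind ((x ≟ᴬ ψ y) ×-dec (Q? y ×-dec P? x))      ≡⟨ merge-ind (x ≟ᴬ ψ y) (Q? y) (P? x) ⟨
        ind (x ≟ᴬ ψ y) * (ind (Q? y) * ind (P? x))    ∎
        where
        merge-ind : ∀ {X Y Z : Set} (a : Dec X) (b : Dec Y) (c : Dec Z) →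
                    ind a * (ind b * ind c) ≡ ind (a ×-dec (b ×-dec c))
        merge-ind a b c = sym (trans (ind-× a (b ×-dec c)) (cong (ind a *_) (ind-× b c)))

  Sum-truncate : ∀ {P : ℕ → Set} (P? : ∀ c → Dec (P c)) {b T} → b ≤ T →
                 (∀ c → c ≤ b → P c) → (∀ c → P c → c ≤ b) → (F : ℕ → ℕ) →
                 Sum (applyUpTo suc T) (λ c → ind (P? c) * F c) ≡ Sum (applyUpTo suc b) F
  Sum-truncate P? {T = zero}  z≤n _   _ F = refl
  Sum-truncate P? {b} {suc T} b≤T low high F with m≤n⇒m<n∨m≡n b≤T
  ... | inj₂ refl = Sum-cong (applyUpTo suc b) λ c c∈ →
    trans (cong (_* F c) (ind-yes (P? c) (low c (bounded c c∈)))) (+-identityʳ (F c))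
    where
    bounded : ∀ c → c ∈ˡ applyUpTo suc b → c ≤ b
    bounded c c∈ with ∈ˡ.∈-applyUpTo⁻ suc c∈
    ... | _ , i<b , refl = i<b
  ... | inj₁ (s≤s b≤T′) = begin
    Sum (applyUpTo suc (suc T)) G      ≡⟨ Sum-applyUpTo-∷ʳ suc T G ⟩
    Sum (applyUpTo suc T) G + G (suc T) ≡⟨ cong (Sum (applyUpTo suc T) G +_)
      (cong (_* F (suc T)) (ind-no (P? (suc T)) λ p → 1+n≰n (≤-trans (high _ p) b≤T′))) ⟩
    Sum (applyUpTo suc T) G + 0        ≡⟨ +-identityʳ _ ⟩
    Sum (applyUpTo suc T) G            ≡⟨ Sum-truncate P? b≤T′ low high F ⟩
    Sum (applyUpTo suc b) F            ∎
    where G = λ c → ind (P? c) * F c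

  -- Sequences with prescribed weak and strict steps.

  module Chains {M : ℕ → Set} (M? : ∀ k → Dec (M k)) where

    -- `c` is the value of the letter `k` and `b` that of the letter `k + 1`; `M k` permits a tie
    -- between them.
    Step : ℕ → ℕ → ℕ → Set
    Step k c b = c < b ⊎ (c ≡ b × M k)

    step? : ∀ k c b → Dec (Step k c b)
    step? k c b = (c ℕ.<? b) ⊎-dec ((c ℕ.≟ b) ×-dec M? k)

    -- The head of a vector of length k is the value given to the letter k, so values
    -- are listed from the largest letter down to the letter 1.
    Chain : ∀ {k} → Vec ℕ k → Set
    Chain                 []          = ⊤
    Chain                 (_ ∷ [])    = ⊤
    Chain {suc (suc k)}   (b ∷ c ∷ f) = Step (suc k) c b × Chain (c ∷ f)

    chain? : ∀ {k} (f : Vec ℕ k) → Dec (Chain f)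
    chain?               []          = yes tt
    chain?               (_ ∷ [])    = yes tt
    chain? {suc (suc k)} (b ∷ c ∷ f) = step? (suc k) c b ×-dec chain? (c ∷ f)

    #M : ℕ → ℕ
    #M zero    = 0
    #M (suc k) = #M k + ind (M? (suc k))

    #M≤ : ∀ k → #M k ≤ k
    #M≤ zero    = z≤n
    #M≤ (suc k) = ≤-trans (+-mono-≤ (#M≤ k) (ind≤1 (M? (suc k)))) (≤-reflexive (+-comm k 1))

    private
      chains : ℕ → ∀ k → ℕ → ℕ
      chains T k b = Sum (words T k) λ f → ind (chain? (b ∷ f))

    -- Below the top value `suc b` the next value ranges over 1,...,b, or up to `suc b` when
    -- `M (suc k)` permits a tie; `b < T` keeps this range inside the alphabet.
    chains-∷ : ∀ {T b} k → b < T → chains T (suc k) (suc b) ≡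
               Sum (applyUpTo suc (b + ind (M? (suc k)))) (chains T k)
    chains-∷ {T} {b} k b<T = begin
      Sum (words T (suc k)) (λ f → ind (chain? (suc b ∷ f)))
        ≡⟨ Sum-cartesianProductWith _∷_ (applyUpTo suc T) (words T k) _ ⟩
      Sum (applyUpTo suc T) (λ c → Sum (words T k) λ f →
        ind (step? (suc k) c (suc b) ×-dec chain? (c ∷ f)))
        ≡⟨ Sum-cong (applyUpTo suc T) (λ c _ → trans
             (Sum-cong (words T k) λ f _ → ind-× (step? (suc k) c (suc b)) (chain? (c ∷ f)))
             (Sum-*ˡ (ind (step? (suc k) c (suc b))) (words T k) _)) ⟩
      Sum (applyUpTo suc T) (λ c → ind (step? (suc k) c (suc b)) * chains T k c)
        ≡⟨ truncate (M? (suc k)) ⟩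
      Sum (applyUpTo suc (b + ind (M? (suc k)))) (chains T k) ∎
      where
      truncate : (m? : Dec (M (suc k))) →
                 Sum (applyUpTo suc T) (λ c → ind (step? (suc k) c (suc b)) * chains T k c) ≡
                 Sum (applyUpTo suc (b + ind m?)) (chains T k)
      truncate (yes m) rewrite +-comm b 1 = Sum-truncate (λ c → step? (suc k) c (suc b)) b<T
        low (λ { c (inj₁ lt) → <⇒≤ lt ; c (inj₂ (refl , _)) → ≤-refl }) (chains T k)
        where
        low : ∀ c → c ≤ suc b → Step (suc k) c (suc b)
        low c le with m≤n⇒m<n∨m≡n le
        ... | inj₁ lt   = inj₁ lt
        ... | inj₂ refl = inj₂ (refl , m)
      truncate (no ¬m) rewrite +-identityʳ b = Sum-truncate (λ c → step? (suc k) c (suc b))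
        (<⇒≤ b<T) (λ _ le → inj₁ (s≤s le))
        (λ { c (inj₁ lt) → s≤s⁻¹ lt ; c (inj₂ (_ , m)) → contradiction m ¬m }) (chains T k)

    -- Hockey-stick summation, where `l` bounds the top value. By `chains-∷` the top value `suc l`
    -- contributes the sum for `k` with bound `l + ind (M? (suc k))`, which by induction is
    -- `(l + #M (suc k)) C suc k`. Pascal's rule adds it to the terms with top value at most `l`.
    Sum-chains : ∀ {T} k l → l ≤ T → Sum (applyUpTo suc l) (chains T k) ≡ (l + #M k) C suc k
    Sum-chains {T} zero l l≤T = begin
      Sum (applyUpTo suc l) (λ _ → 1)  ≡⟨ ones l ⟩
      l                                ≡⟨ nC1≡n l ⟨
      l C 1                            ≡⟨ cong (_C 1) (+-identityʳ l) ⟨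
      (l + 0) C 1                      ∎
      where
      ones : ∀ l → Sum (applyUpTo suc l) (λ _ → 1) ≡ l
      ones zero    = refl
      ones (suc l) = trans (Sum-applyUpTo-∷ʳ suc l _)
                       (trans (cong (_+ 1) (ones l)) (+-comm l 1))
    -- No top value is available, and the binomial coefficient is zero because `#M (suc k)` is at
    -- most `suc k`.
    Sum-chains (suc k) zero _ = sym (k>n⇒nCk≡0 (s≤s (#M≤ (suc k))))
    Sum-chains {T} (suc k) (suc l) l<T = begin
      Sum (applyUpTo suc (suc l)) (chains T (suc k))
        ≡⟨ Sum-applyUpTo-∷ʳ suc l _ ⟩
      Sum (applyUpTo suc l) (chains T (suc k)) + chains T (suc k) (suc l)
        ≡⟨ cong₂ _+_ (Sum-chains (suc k) l (<⇒≤ l<T)) (trans (chains-∷ k l<T)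
             (Sum-chains k (l + ind (M? (suc k))) (≤-trans (+-monoʳ-≤ l (ind≤1 (M? (suc k))))
               (≤-trans (≤-reflexive (+-comm l 1)) l<T)))) ⟩
      (l + #M (suc k)) C suc (suc k) + (l + ind (M? (suc k)) + #M k) C suc k
        ≡⟨ cong (λ m → (l + #M (suc k)) C suc (suc k) + m C suc k)
             (trans (+-assoc l _ _) (cong (l +_) (+-comm _ (#M k)))) ⟩
      (l + #M (suc k)) C suc (suc k) + (l + #M (suc k)) C suc k
        ≡⟨ +-comm ((l + #M (suc k)) C suc (suc k)) _ ⟩
      (l + #M (suc k)) C suc k + (l + #M (suc k)) C suc (suc k)
        ≡⟨ nCk+nC[k+1]≡[n+1]C[k+1] (l + #M (suc k)) (suc k) ⟩
      (suc l + #M (suc k)) C suc (suc k) ∎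

    chain-count : ∀ T r → Sum (words T r) (λ f → ind (chain? f)) ≡ (T + #M (r ∸ 1)) C r
    chain-count T zero    = refl
    chain-count T (suc k) =
      trans (Sum-cartesianProductWith _∷_ (applyUpTo suc T) (words T k) _)
            (Sum-chains k T ≤-refl)

  -- Words as independent families of subwords.

  Prod : ℕ → (ℕ → ℕ) → ℕ
  Prod zero    f = 1
  Prod (suc r) f = Prod r f * f (suc r)

  Prod-cong : ∀ r {f g : ℕ → ℕ} → (∀ c → 1 ≤ c → c ≤ r → f c ≡ g c) → Prod r f ≡ Prod r g
  Prod-cong zero    eq = refl
  Prod-cong (suc r) eq = cong₂ _*_ (Prod-cong r λ c 1≤c c≤r → eq c 1≤c (m≤n⇒m≤1+n c≤r))
                                   (eq (suc r) (s≤s z≤n) ≤-refl)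

  ind-Prod : ∀ {P : Set} {Q : ℕ → Set} r (p? : Dec P) (q? : ∀ c → Dec (Q c)) →
             (P → ∀ c → 1 ≤ c → c ≤ r → Q c) → ((∀ c → 1 ≤ c → c ≤ r → Q c) → P) →
             ind p? ≡ Prod r (λ c → ind (q? c))
  ind-Prod zero p? q? to from = ind-yes p? (from λ { .0 () z≤n })
  ind-Prod {Q = Q} (suc r) p? q? to from with q? (suc r)
  ... | no ¬q = trans (ind-no p? λ p → ¬q (to p (suc r) (s≤s z≤n) ≤-refl)) (sym (*-zeroʳ (Prod r _)))
  ... | yes q = trans (ind-Prod r p? q? (λ p c 1≤c c≤r → to p c 1≤c (m≤n⇒m≤1+n c≤r)) from′)
                      (sym (*-identityʳ _))
    where
    from′ : (∀ c → 1 ≤ c → c ≤ r → Q c) → _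
    from′ h = from λ c 1≤c c≤1+r → case-≤ c 1≤c (m≤n⇒m<n∨m≡n c≤1+r)
      where
      case-≤ : ∀ c → 1 ≤ c → c < suc r ⊎ c ≡ suc r → Q c
      case-≤ c 1≤c (inj₁ c<) = h c 1≤c (s≤s⁻¹ c<)
      case-≤ c _   (inj₂ refl) = q

  -- The factors away from `x` do not see `a` and come out of the sum. In the application `x` is the
  -- first letter of `u`: it indexes the only factor that the first letter of a word can affect.
  Sum-Prod-single : ∀ (xs : List A) (h : A → ℕ → ℕ) (g : ℕ → ℕ) {x} r → 1 ≤ x → x ≤ r →
                    (∀ a c → c ≢ x → h a c ≡ g c) → Sum xs (λ a → h a x) ≡ g x →
                    Sum xs (λ a → Prod r (h a)) ≡ Prod r g
  Sum-Prod-single xs h g zero (s≤s _) () _ _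
  Sum-Prod-single xs h g {x} (suc r) 1≤x x≤1+r off on with m≤n⇒m<n∨m≡n x≤1+r
  ... | inj₂ refl = begin
    Sum xs (λ a → Prod r (h a) * h a (suc r))  ≡⟨ Sum-cong xs (λ a _ → cong (_* h a (suc r))
      (Prod-cong r λ c _ c≤r → off a c (<⇒≢ (s≤s c≤r)))) ⟩
    Sum xs (λ a → Prod r g * h a (suc r))      ≡⟨ Sum-*ˡ (Prod r g) xs _ ⟩
    Prod r g * Sum xs (λ a → h a (suc r))      ≡⟨ cong (Prod r g *_) on ⟩
    Prod r g * g (suc r)                       ∎
  ... | inj₁ (s≤s x≤r) = begin
    Sum xs (λ a → Prod r (h a) * h a (suc r))  ≡⟨ Sum-cong xs (λ a _ → cong (Prod r (h a) *_)
      (off a (suc r) (>⇒≢ (s≤s x≤r)))) ⟩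
    Sum xs (λ a → Prod r (h a) * g (suc r))    ≡⟨ Sum-*ʳ (g (suc r)) xs _ ⟩
    Sum xs (λ a → Prod r (h a)) * g (suc r)    ≡⟨ cong (_* g (suc r))
      (Sum-Prod-single xs h g r 1≤x x≤r off on) ⟩
    Prod r g * g (suc r)                       ∎

  #[_] : ∀ {n} → Word n → ℕ → ℕ
  #[ u ] c = count (ℕ._≟ c) u

  -- The effect on the `c`-subword of prepending `a` at a position where `u` has the letter `x`.
  -- Detached from `subword`, it acts on arbitrary words, as the induction for `Sum-Prod-subword`
  -- requires.
  extend : ∀ {n} x (u : Word n) c → ℕ → Word (#[ u ] c) → Word (#[ x ∷ u ] c)
  extend x u c a z with does (x ℕ.≟ c)
  ... | true  = a ∷ z
  ... | false = z

  subword-∷ : ∀ {n} x (u : Word n) c a z → subword (x ∷ u) c (a ∷ z) ≡ extend x u c a (subword u c z)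
  subword-∷ x u c a z with does (x ℕ.≟ c)
  ... | true  = refl
  ... | false = refl

  Sum-extend-≢ : ∀ {n} T x (u : Word n) c a → c ≢ x → (F : Word (#[ x ∷ u ] c) → ℕ) →
                 Sum (words T (#[ u ] c)) (F ∘ extend x u c a) ≡ Sum (words T (#[ x ∷ u ] c)) F
  -- `#[_]` and `extend` both branch on `does (x ℕ.≟ c)`, which computes to `x ≡ᵇ c`. Abstracting
  -- this Boolean reduces the types and the function together, while `proof` retains its meaning.
  Sum-extend-≢ T x u c a c≢x F with x ≡ᵇ c | proof (x ℕ.≟ c)
  ... | true  | ofʸ x≡c = contradiction (sym x≡c) c≢x
  ... | false | _       = refl

  Sum-extend-≡ : ∀ {n} T x (u : Word n) (F : Word (#[ x ∷ u ] x) → ℕ) →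
                 Sum (applyUpTo suc T) (λ a → Sum (words T (#[ u ] x)) (F ∘ extend x u x a)) ≡
                 Sum (words T (#[ x ∷ u ] x)) F
  Sum-extend-≡ T x u F with x ≡ᵇ x | proof (x ℕ.≟ x)
  ... | true  | _       = sym (Sum-cartesianProductWith _∷_ (applyUpTo suc T) (words T (#[ u ] x)) F)
  ... | false | ofⁿ x≢x = contradiction refl x≢x

  -- A word amounts to an independent choice of its subwords at the letters of `u`. Induction on `u`
  -- with distributivity avoids writing down the inverse shuffle: `extend` absorbs the first letter
  -- into the functions `F`.
  Sum-Prod-subword : ∀ {n} T r (u : Word n) → (∀ i → 1 ≤ lookup u i × lookup u i ≤ r) →
                     (F : ∀ c → Word (#[ u ] c) → ℕ) →
                     Sum (words T n) (λ z → Prod r λ c → F c (subword u c z)) ≡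
                     Prod r (λ c → Sum (words T (#[ u ] c)) (F c))
  Sum-Prod-subword T r [] _ F =
    trans (+-identityʳ _) (Prod-cong r λ c _ _ → sym (+-identityʳ (F c [])))
  Sum-Prod-subword {suc n} T r (x ∷ u) u∈ F = begin
    Sum (words T (suc n)) (λ z → Prod r λ c → F c (subword (x ∷ u) c z))
      ≡⟨ Sum-cartesianProductWith _∷_ (applyUpTo suc T) (words T n) _ ⟩
    Sum (applyUpTo suc T) (λ a → Sum (words T n) λ z → Prod r λ c → F c (subword (x ∷ u) c (a ∷ z)))
      ≡⟨ Sum-cong (applyUpTo suc T) (λ a _ → trans
           (Sum-cong (words T n) λ z _ → Prod-cong r λ c _ _ → cong (F c) (subword-∷ x u c a z))
           (Sum-Prod-subword T r u (u∈ ∘ suc) λ c → F c ∘ extend x u c a)) ⟩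
    Sum (applyUpTo suc T) (λ a → Prod r λ c → Sum (words T (#[ u ] c)) (F c ∘ extend x u c a))
      ≡⟨ Sum-Prod-single (applyUpTo suc T) _ _ r (proj₁ (u∈ zero)) (proj₂ (u∈ zero))
           (λ a c c≢x → Sum-extend-≢ T x u c a c≢x (F c)) (Sum-extend-≡ T x u (F x)) ⟩
    Prod r (λ c → Sum (words T (#[ x ∷ u ] c)) (F c)) ∎

  extend-head : ∀ {n} {x} (u : Word n) {c} → x ≡ c →
                ∃[ k ] ∀ a z → lookup (extend x u c a z) k ≡ a
  extend-head {x = x} u {c} x≡c with x ≡ᵇ c | proof (x ℕ.≟ c)
  ... | true  | _       = zero , λ _ _ → refl
  ... | false | ofⁿ x≢c = contradiction x≡c x≢c

  extend-tail : ∀ {n} x (u : Word n) c (k : Fin (#[ u ] c)) →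
                ∃[ k′ ] ∀ a z → lookup (extend x u c a z) k′ ≡ lookup z k
  extend-tail x u c k with x ≡ᵇ c
  ... | true  = suc k , λ _ _ → refl
  ... | false = k , λ _ _ → refl

  extend⁻ : ∀ {n} x (u : Word n) c (k : Fin (#[ x ∷ u ] c)) →
            (x ≡ c × ∀ a z → lookup (extend x u c a z) k ≡ a) ⊎
            (∃[ k′ ] ∀ a z → lookup (extend x u c a z) k ≡ lookup z k′)
  extend⁻ x u c k with x ≡ᵇ c | proof (x ℕ.≟ c)
  extend⁻ x u c zero    | true  | ofʸ x≡c = inj₁ (x≡c , λ _ _ → refl)
  extend⁻ x u c (suc k) | true  | _       = inj₂ (k , λ _ _ → refl)
  extend⁻ x u c k       | false | _       = inj₂ (k , λ _ _ → refl)

  -- One position `k` serves all `y` at once, so that the subwords of `v`, `w` and `z` can be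
  -- compared at the same place.
  subword-lookup⁺ : ∀ {n} (u : Word n) {c} i → lookup u i ≡ c →
                    ∃[ k ] ∀ y → lookup (subword u c y) k ≡ lookup y i
  subword-lookup⁺ (x ∷ u) {c} zero eq = let k , h = extend-head u eq in
    k , λ { (a ∷ y) → trans (cong (λ z → lookup z k) (subword-∷ x u c a y)) (h a _) }
  subword-lookup⁺ (x ∷ u) {c} (suc i) eq =
    let k , h   = subword-lookup⁺ u i eq
        k′ , h′ = extend-tail x u c k
    in k′ , λ { (a ∷ y) → trans (cong (λ z → lookup z k′) (subword-∷ x u c a y))
                                (trans (h′ a _) (h y)) }

  subword-lookup⁻ : ∀ {n} (u : Word n) c (k : Fin (#[ u ] c)) →
                    ∃[ i ] lookup u i ≡ c × ∀ y → lookup (subword u c y) k ≡ lookup y i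
  subword-lookup⁻ (x ∷ u) c k with extend⁻ x u c k
  ... | inj₁ (x≡c , h) = zero , x≡c ,
    λ { (a ∷ y) → trans (cong (λ z → lookup z k) (subword-∷ x u c a y)) (h a _) }
  ... | inj₂ (k′ , h) = let i , eq , h′ = subword-lookup⁻ u c k′ in suc i , eq ,
    λ { (a ∷ y) → trans (cong (λ z → lookup z k) (subword-∷ x u c a y)) (trans (h a _) (h′ y)) }

  -- Packed words as orders on the positions.

  record Represents {n} (w : Word n) (R : Fin n → Fin n → Set) : Set where
    constructor mkRepresents
    field
      sound    : ∀ i j → lookup w i < lookup w j → R i j
      complete : ∀ i j → R i j → lookup w i < lookup w j

    tie⇒¬ : ∀ {i j} → lookup w i ≡ lookup w j → ¬ R i j
    tie⇒¬ eq r = <⇒≢ (complete _ _ r) eq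

    ¬⇒tie : ∀ {i j} → ¬ R i j → ¬ R j i → lookup w i ≡ lookup w j
    ¬⇒tie ¬Rij ¬Rji = ≤-antisym (≮⇒≥ (¬Rji ∘ sound _ _)) (≮⇒≥ (¬Rij ∘ sound _ _))

  open Represents

  represents? : ∀ {n} (w : Word n) {R : Fin n → Fin n → Set} → (∀ i j → Dec (R i j)) →
                Dec (Represents w R)
  represents? w R? = map′
    (λ h → mkRepresents (λ i j → proj₁ (h i j)) (λ i j → proj₂ (h i j)))
    (λ rep i j → sound rep i j , complete rep i j)
    (all? λ i → all? λ j → ((_ ℕ.<? _) →-dec R? i j) ×-dec (R? i j →-dec (_ ℕ.<? _)))

  -- Completeness follows from soundness by trichotomy: a tie is excluded by the second hypothesis,
  -- the opposite comparison by asymmetry.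
  Represents-mono : ∀ {n} {w : Word n} {R} → (∀ i j → lookup w i < lookup w j → R i j) →
                    (∀ i j → lookup w i ≡ lookup w j → ¬ R i j) →
                    (∀ {i j} → R i j → ¬ R j i) → Represents w R
  Represents-mono {w = w} {R} mono irrefl asym = mkRepresents mono reflect
    where
    reflect : ∀ i j → R i j → lookup w i < lookup w j
    reflect i j r with <-cmp (lookup w i) (lookup w j)
    ... | tri< lt _ _ = lt
    ... | tri≈ _ eq _ = contradiction r (irrefl i j eq)
    ... | tri> _ _ gt = contradiction (mono j i gt) (asym r)

  lookup-ext : ∀ {n} {x y : Word n} → (∀ i → lookup x i ≡ lookup y i) → x ≡ y
  lookup-ext {x = x} {y} eq = begin
    x                       ≡⟨ Vec.tabulate∘lookup x ⟨
    Vec.tabulate (lookup x) ≡⟨ Vec.tabulate-cong eq ⟩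
    Vec.tabulate (lookup y) ≡⟨ Vec.tabulate∘lookup y ⟩
    y                       ∎

  module _ {n} {w : Word n} (packed : Packed w) where

    letter≥1 : ∀ i → 1 ≤ lookup w i
    letter≥1 i = proj₁ (Equivalence.to (proj₂ packed _) (∈ᵛ.∈-lookup i w))

    letter-occurs : ∀ {x} → 1 ≤ x → x ≤ max w → ∃[ i ] lookup w i ≡ x
    letter-occurs 1≤x x≤max = VAny.index x∈w , sym (VAny.lookup-index x∈w)
      where
      x∈w = Equivalence.from (proj₂ packed _) (1≤x , ≤-trans x≤max
        (max-least w λ k∈w → proj₂ (Equivalence.to (proj₂ packed _) k∈w)))

  -- Below a position with letter `k`, the packed word `w` has positions with the letters k - 1,
  -- ..., 1. Along this chain the letters of `w′` are strictly increasing and start at 1 or more, so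
  -- they reach at least `k`.
  packed-≤ : ∀ {n} {w w′ : Word n} → Packed w → Packed w′ →
             (∀ i j → lookup w i < lookup w j → lookup w′ i < lookup w′ j) →
             ∀ k i → lookup w i ≡ k → k ≤ lookup w′ i
  packed-≤ p p′ mono zero          i eq = z≤n
  packed-≤ p p′ mono (suc zero)    i eq = letter≥1 p′ i
  packed-≤ {w = w} p p′ mono (suc (suc k)) i eq =
    let j , wj≡1+k = letter-occurs p (s≤s z≤n)
          (≤-trans (n≤1+n (suc k)) (≤-trans (≤-reflexive (sym eq)) (lookup≤max w i)))
    in ≤-trans (s≤s (packed-≤ p p′ mono (suc k) j wj≡1+k))
               (mono j i (≤-reflexive (trans (cong suc wj≡1+k) (sym eq))))

  packed-unique : ∀ {n} {w w′ : Word n} {R} → Packed w → Packed w′ →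
                  Represents w R → Represents w′ R → w ≡ w′
  packed-unique p p′ rep rep′ = lookup-ext λ i → ≤-antisym
    (packed-≤ p p′ (λ i j lt → complete rep′ i j (sound rep i j lt)) _ i refl)
    (packed-≤ p′ p (λ i j lt → complete rep i j (sound rep′ i j lt)) _ i refl)

  module _ {a ℓ₁ ℓ₂} {A : Set a} {P : A → Set ℓ₁} {Q : A → Set ℓ₂}
           (P? : ∀ x → Dec (P x)) (Q? : ∀ x → Dec (Q x)) (P⇒Q : ∀ {x} → P x → Q x) where

    length-filter-≤ : ∀ xs → length (filter P? xs) ≤ length (filter Q? xs)
    length-filter-≤ []       = z≤n
    length-filter-≤ (x ∷ xs) with P? x | Q? x
    ... | yes _ | yes _  = s≤s (length-filter-≤ xs)
    ... | yes p | no  ¬q = contradiction (P⇒Q p) ¬q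
    ... | no  _ | yes _  = m≤n⇒m≤1+n (length-filter-≤ xs)
    ... | no  _ | no  _  = length-filter-≤ xs

  module _ {a ℓ₁} (A : StrictTotalOrder a ℓ₁ Level.zero) where

    open StrictTotalOrder A
      using (Carrier; _≈_; _≟_; _<?_; compare; module Eq)
      renaming (_<_ to _≺_; trans to ≺-trans; <-respʳ-≈ to ≺-respʳ-≈)
    open Packing A using (letters; rank; rank-mono; packWord)

    packWord-represents : ∀ {n} (s : Vec Carrier n) →
                          Represents (packWord s) (λ i j → lookup s i ≺ lookup s j)
    packWord-represents s = mkRepresents
      (λ i j lt → reflect (subst₂ _<_ (Vec.lookup-map i (rank s) s) (Vec.lookup-map j (rank s) s) lt))
      (λ i j i≺j → subst₂ _<_ (sym (Vec.lookup-map i (rank s) s)) (sym (Vec.lookup-map j (rank s) s))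
                     (rank-mono s (s∈ i) i≺j))
      where
      s∈ : ∀ i → Any (lookup s i ≈_) (letters s)
      s∈ i = Any.deduplicate⁺ _≟_ (λ z≈y x≈y → Eq.trans x≈y (Eq.sym z≈y))
             (Any.map Eq.reflexive (∈ᵛ.∈-toList⁺ (∈ᵛ.∈-lookup i s)))
      rank-≤ : ∀ {x y} → (∀ {z} → z ≺ y → z ≺ x) → rank s y ≤ rank s x
      rank-≤ {x} {y} below = s≤s (length-filter-≤ (_<? y) (_<? x) below (letters s))
      reflect : ∀ {i j} → rank s (lookup s i) < rank s (lookup s j) → lookup s i ≺ lookup s j
      reflect {i} {j} lt with compare (lookup s i) (lookup s j)
      ... | tri< i≺j _ _ = i≺j
      ... | tri≈ _ i≈j _ = contradiction lt (≤⇒≯ (rank-≤ λ z≺j → ≺-respʳ-≈ (Eq.sym i≈j) z≺j))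
      ... | tri> _ _ j≺i = contradiction lt (≤⇒≯ (rank-≤ λ z≺j → ≺-trans z≺j j≺i))

  -- Counting the words with a given lexicographic pattern.

  Lex : ∀ {n} → Word n → Word n → Fin n → Fin n → Set
  Lex z v i j = lookup z i < lookup z j ⊎ (lookup z i ≡ lookup z j × lookup v i < lookup v j)

  lex? : ∀ {n} (z v : Word n) i j → Dec (Lex z v i j)
  lex? z v i j = (_ ℕ.<? _) ⊎-dec ((_ ℕ.≟ _) ×-dec (_ ℕ.<? _))

  Lex-asym : ∀ {n} (z v : Word n) {i j} → Lex z v i j → ¬ Lex z v j i
  Lex-asym z v (inj₁ lt)        (inj₁ gt)       = <-asym lt gt
  Lex-asym z v (inj₁ lt)        (inj₂ (eq , _)) = <⇒≢ lt (sym eq)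
  Lex-asym z v (inj₂ (eq , _))  (inj₁ gt)       = <⇒≢ gt (sym eq)
  Lex-asym z v (inj₂ (_ , lt))  (inj₂ (_ , gt)) = <-asym lt gt

  Lex-irrefl : ∀ {n} (z v : Word n) {i j} → lookup z i ≡ lookup z j → lookup v i ≡ lookup v j →
               ¬ Lex z v i j
  Lex-irrefl z v zeq veq (inj₁ lt)       = <⇒≢ lt zeq
  Lex-irrefl z v zeq veq (inj₂ (_ , lt)) = <⇒≢ lt veq

  ¬Lex⇒≡ : ∀ {n} (z v : Word n) {i j} → ¬ Lex z v i j → ¬ Lex z v j i →
           lookup z i ≡ lookup z j × lookup v i ≡ lookup v j
  ¬Lex⇒≡ z v {i} {j} ¬ij ¬ji with <-cmp (lookup z i) (lookup z j) | <-cmp (lookup v i) (lookup v j)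
  ... | tri< lt _ _ | _             = contradiction (inj₁ lt) ¬ij
  ... | tri> _ _ gt | _             = contradiction (inj₁ gt) ¬ji
  ... | tri≈ _ eq _ | tri< lt _ _   = contradiction (inj₂ (eq , lt)) ¬ij
  ... | tri≈ _ eq _ | tri≈ _ veq _  = eq , veq
  ... | tri≈ _ eq _ | tri> _ _ gt   = contradiction (inj₂ (sym eq , gt)) ¬ji

  words-bounds : ∀ {T n} {z : Word n} → z ∈ˡ words T n → ∀ i → 1 ≤ lookup z i × lookup z i ≤ T
  words-bounds {T} {suc n} z∈ i with ∈ˡ.∈-cartesianProductWith⁻ _∷_ (List.applyUpTo suc T) (words T n) z∈
  words-bounds z∈ zero    | a , z′ , a∈ , z′∈ , refl with ∈ˡ.∈-applyUpTo⁻ suc a∈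
  ... | _ , a<T , refl = s≤s z≤n , a<T
  words-bounds z∈ (suc i) | a , z′ , a∈ , z′∈ , refl = words-bounds z′∈ i

  bounds⇒∈words : ∀ {T n} {z : Word n} → (∀ i → 1 ≤ lookup z i × lookup z i ≤ T) → z ∈ˡ words T n
  bounds⇒∈words {T} {z = z} h = ∈-words z λ k∈ →
    subst (λ k → 1 ≤ k × k ≤ T) (sym (VAny.lookup-index k∈)) (h (VAny.index k∈))

  table : ∀ k → (ℕ → ℕ) → Vec ℕ k
  table zero    g = []
  table (suc k) g = g (suc k) ∷ table k g

  -- Reads a value in the order of `Chain`, largest letter first; outside 1,...,k the result is the
  -- dummy 0.
  at : ∀ {k} → Vec ℕ k → ℕ → ℕ
  at         []      x = 0
  at {suc k} (b ∷ f) x with x ℕ.≟ suc k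
  ... | yes _ = b
  ... | no  _ = at f x

  at-head : ∀ {k} b (f : Vec ℕ k) → at (b ∷ f) (suc k) ≡ b
  at-head {k} b f with suc k ℕ.≟ suc k
  ... | yes _  = refl
  ... | no k≢k = contradiction refl k≢k

  at-tail : ∀ {k x} b (f : Vec ℕ k) → x ≤ k → at (b ∷ f) x ≡ at f x
  at-tail {k} {x} b f x≤k with x ℕ.≟ suc k
  ... | yes x≡1+k = contradiction x≡1+k (<⇒≢ (s≤s x≤k))
  ... | no  _     = refl

  at-table : ∀ k g {x} → 1 ≤ x → x ≤ k → at (table k g) x ≡ g x
  at-table zero    g (s≤s _) ()
  at-table (suc k) g 1≤x x≤1+k with m≤n⇒m<n∨m≡n x≤1+k
  ... | inj₁ (s≤s x≤k) = trans (at-tail (g (suc k)) (table k g) x≤k) (at-table k g 1≤x x≤k)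
  ... | inj₂ refl      = at-head (g (suc k)) (table k g)

  table-at : ∀ {k} (f : Vec ℕ k) g → (∀ {x} → 1 ≤ x → x ≤ k → g x ≡ at f x) → table k g ≡ f
  table-at []      g eq = refl
  table-at (b ∷ f) g eq = cong₂ _∷_ (trans (eq (s≤s z≤n) ≤-refl) (at-head b f))
    (table-at f g λ 1≤x x≤k → trans (eq 1≤x (m≤n⇒m≤1+n x≤k)) (at-tail b f x≤k))

  lookup-table : ∀ k g (i : Fin k) → ∃[ x ] 1 ≤ x × x ≤ k × lookup (table k g) i ≡ g x
  lookup-table (suc k) g zero    = suc k , s≤s z≤n , ≤-refl , refl
  lookup-table (suc k) g (suc i) =
    let x , 1≤x , x≤k , eq = lookup-table k g i in x , 1≤x , m≤n⇒m≤1+n x≤k , eq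

  at-lookup : ∀ {k} (f : Vec ℕ k) {x} → 1 ≤ x → x ≤ k → ∃[ i ] at f x ≡ lookup f i
  at-lookup []      (s≤s _) ()
  at-lookup (b ∷ f) 1≤x x≤1+k with m≤n⇒m<n∨m≡n x≤1+k
  ... | inj₁ (s≤s x≤k) = let i , eq = at-lookup f 1≤x x≤k in suc i , trans (at-tail b f x≤k) eq
  ... | inj₂ refl      = zero , at-head b f

  module _ {M : ℕ → Set} (M? : ∀ k → Dec (M k)) where

    open Chains M?

    chain⁺ : ∀ k g → (∀ {x} → 1 ≤ x → x < k → Step x (g x) (g (suc x))) → Chain (table k g)
    chain⁺ zero          g step = tt
    chain⁺ (suc zero)    g step = tt
    chain⁺ (suc (suc k)) g step =
      step (s≤s z≤n) ≤-refl , chain⁺ (suc k) g (λ 1≤x x<k → step 1≤x (m≤n⇒m≤1+n x<k))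

    chain⁻ : ∀ {k} (f : Vec ℕ k) → Chain f → ∀ {x} → 1 ≤ x → x < k → Step x (at f x) (at f (suc x))
    chain⁻ (_ ∷ [])    _          (s≤s z≤n) (s≤s ())
    chain⁻ {suc (suc k)} (b ∷ c ∷ f) (s , chain) {x} 1≤x (s≤s x≤1+k) =
      extend-steps (chain⁻ (c ∷ f) chain) (m≤n⇒m<n∨m≡n x≤1+k)
      where
      extend-steps : (∀ {y} → 1 ≤ y → y < suc k → Step y (at (c ∷ f) y) (at (c ∷ f) (suc y))) →
                     x < suc k ⊎ x ≡ suc k → Step x (at (b ∷ c ∷ f) x) (at (b ∷ c ∷ f) (suc x))
      extend-steps _  (inj₂ refl)  = subst₂ (Step x)
        (sym (trans (at-tail b (c ∷ f) ≤-refl) (at-head c f))) (sym (at-head b (c ∷ f))) s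
      extend-steps ih (inj₁ x<1+k) = subst₂ (Step x)
        (sym (at-tail b (c ∷ f) (<⇒≤ x<1+k))) (sym (at-tail b (c ∷ f) x<1+k)) (ih 1≤x x<1+k)

  -- The value of z on the letter x of w, when z is constant on the blocks of w; 0 when x
  -- is not a letter of w.
  value : ∀ {n} → Word n → Word n → ℕ → ℕ
  value w z x with any? (λ i → lookup w i ℕ.≟ x)
  ... | yes (i , _) = lookup z i
  ... | no  _       = 0

  value-lookup : ∀ {n} (w z : Word n) {x} i → lookup w i ≡ x →
                 ∃[ j ] lookup w j ≡ x × value w z x ≡ lookup z j
  value-lookup w z {x} i eq with any? (λ i → lookup w i ℕ.≟ x)
  ... | yes (j , eq′) = j , eq′ , refl
  ... | no  ¬∃        = contradiction (i , eq) ¬∃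

  module _ {n} {w : Word n} (v : Word n) (packed : Packed w)
           (wref : ∀ i j → lookup w i ≡ lookup w j → lookup v i ≡ lookup v j) where

    private
      r : ℕ
      r = max w

      V : ℕ → ℕ
      V = value w v

    open Chains (mergeable? v w)

    V-lookup : ∀ i → V (lookup w i) ≡ lookup v i
    V-lookup i = let j , eq , veq = value-lookup w v i refl in trans veq (wref j i eq)

    LexV : (ℕ → ℕ) → ℕ → ℕ → Set
    LexV g x y = g x < g y ⊎ (g x ≡ g y × V x < V y)

    -- When `g` ties, mergeability separates the values of `v` on the two blocks. Both blocks are
    -- nonempty because `w` is packed, which supplies the positions to compare.
    step⇒LexV : ∀ g {x} → 1 ≤ x → x < r → Step x (g x) (g (suc x)) → LexV g x (suc x)
    step⇒LexV g 1≤x x<r (inj₁ lt)       = inj₁ lt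
    step⇒LexV g 1≤x x<r (inj₂ (eq , m)) =
      let i , wi = letter-occurs packed 1≤x (<⇒≤ x<r)
          j , wj = letter-occurs packed (s≤s z≤n) x<r
      in inj₂ (eq , subst₂ _<_ (trans (sym (V-lookup i)) (cong V wi))
                               (trans (sym (V-lookup j)) (cong V wj)) (m i j wi wj))

    LexV-trans : ∀ g {x y z} → LexV g x y → LexV g y z → LexV g x z
    LexV-trans g (inj₁ p)       (inj₁ q)        = inj₁ (<-trans p q)
    LexV-trans g (inj₁ p)       (inj₂ (e , _))  = inj₁ (<-≤-trans p (≤-reflexive e))
    LexV-trans g (inj₂ (e , _)) (inj₁ q)        = inj₁ (≤-<-trans (≤-reflexive e) q)
    LexV-trans g (inj₂ (e , p)) (inj₂ (e′ , q)) = inj₂ (trans e e′ , <-trans p q)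

    -- Conditions are imposed on adjacent letters only; transitivity of `LexV` yields all the other
    -- comparisons.
    steps⇒LexV : ∀ g → (∀ {x} → 1 ≤ x → x < r → Step x (g x) (g (suc x))) →
                 ∀ {x} y → 1 ≤ x → x < y → y ≤ r → LexV g x y
    steps⇒LexV g step (suc y) 1≤x (s≤s x≤y) y<r with m≤n⇒m<n∨m≡n x≤y
    ... | inj₂ refl = step⇒LexV g 1≤x y<r (step 1≤x y<r)
    ... | inj₁ x<y  = LexV-trans g (steps⇒LexV g step y 1≤x x<y (<⇒≤ y<r))
                                   (step⇒LexV g 1≤y y<r (step 1≤y y<r))
      where 1≤y = ≤-trans 1≤x (<⇒≤ x<y)

    -- Comparing one position from each of two adjacent blocks gives a strict step of `z`, or a tie
    -- with `v` increasing. By `wref` the word `v` is constant on blocks, so this one inequality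
    -- extends to all positions of both blocks, which is mergeability.
    represents⇒chain : ∀ z → Represents w (Lex z v) → Chain (table r (value w z))
    represents⇒chain z rep = chain⁺ (mergeable? v w) r (value w z) step
      where
      step : ∀ {x} → 1 ≤ x → x < r → Step x (value w z x) (value w z (suc x))
      step {x} 1≤x x<r with letter-occurs packed 1≤x (<⇒≤ x<r) | letter-occurs packed (s≤s z≤n) x<r
      ... | i₀ , wi₀ | j₀ , wj₀ with value-lookup w z i₀ wi₀ | value-lookup w z j₀ wj₀
      ... | i , wi , zi | j , wj , zj with sound rep i j (≤-reflexive (trans (cong suc wi) (sym wj)))
      ... | inj₁ lt        = inj₁ (subst₂ _<_ (sym zi) (sym zj) lt)
      ... | inj₂ (eq , lt) = inj₂ (trans zi (trans eq (sym zj)) , λ i′ j′ wi′ wj′ →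
        subst₂ _<_ (wref i i′ (trans wi (sym wi′))) (wref j j′ (trans wj (sym wj′))) lt)

    chain⇒represents : ∀ (f : Vec ℕ r) → Chain f → Represents w (Lex (Vec.map (at f) w) v)
    chain⇒represents f chain = Represents-mono mono
      (λ i j eq → Lex-irrefl z v (trans (z-lookup i) (trans (cong (at f) eq) (sym (z-lookup j))))
                                 (wref i j eq))
      (Lex-asym z v)
      where
      z = Vec.map (at f) w
      z-lookup : ∀ i → lookup z i ≡ at f (lookup w i)
      z-lookup i = Vec.lookup-map i (at f) w
      mono : ∀ i j → lookup w i < lookup w j → Lex z v i j
      mono i j lt rewrite z-lookup i | z-lookup j | sym (V-lookup i) | sym (V-lookup j) =
        steps⇒LexV (at f) (chain⁻ (mergeable? v w) f chain) (lookup w j) (letter≥1 packed i) lt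
          (lookup≤max w j)

    map-at-table : ∀ z → Represents w (Lex z v) → Vec.map (at (table r (value w z))) w ≡ z
    map-at-table z rep = lookup-ext λ i → begin
      lookup (Vec.map (at f) w) i  ≡⟨ Vec.lookup-map i (at f) w ⟩
      at f (lookup w i)            ≡⟨ at-table r (value w z) (letter≥1 packed i) (lookup≤max w i) ⟩
      value w z (lookup w i)       ≡⟨ z-value i ⟩
      lookup z i                   ∎
      where
      f = table r (value w z)
      z-value : ∀ i → value w z (lookup w i) ≡ lookup z i
      z-value i = let j , wj , eq = value-lookup w z i refl in
        trans eq (proj₁ (¬Lex⇒≡ z v (tie⇒¬ rep wj) (tie⇒¬ rep (sym wj))))

    table-map-at : ∀ (f : Vec ℕ r) → table r (value w (Vec.map (at f) w)) ≡ f
    table-map-at f = table-at f _ λ 1≤x x≤r →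
      let i , wi       = letter-occurs packed 1≤x x≤r
          j , wj , eq  = value-lookup w (Vec.map (at f) w) i wi
      in trans eq (trans (Vec.lookup-map j (at f) w) (cong (at f) wj))

    -- Such a `z` is constant on the blocks of `w`, hence a function of the letters of `w`. The
    -- bijection tabulates that function in one direction and composes it with `w` in the other.
    represents-count : ∀ T → Sum (words T n) (λ z → ind (represents? w (lex? z v))) ≡
                             (T + #M (r ∸ 1)) C r
    represents-count T = trans
      (Sum-bijection (Vec.≡-dec ℕ._≟_) (Vec.≡-dec ℕ._≟_)
        (λ z → represents? w (lex? z v)) chain?
        (λ z → table r (value w z)) (λ f → Vec.map (at f) w)
        (words-unique T n) (words-unique T r)
        (λ z z∈ rep → bounds⇒∈words (table-bounds z z∈) , represents⇒chain z rep , map-at-table z rep)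
        (λ f f∈ chain → bounds⇒∈words (map-bounds f f∈) , chain⇒represents f chain , table-map-at f))
      (chain-count T r)
      where
      table-bounds : ∀ z → z ∈ˡ words T n → ∀ k → 1 ≤ lookup (table r (value w z)) k ×
                                                   lookup (table r (value w z)) k ≤ T
      table-bounds z z∈ k =
        let x , 1≤x , x≤r , eq = lookup-table r (value w z) k
            i , wi             = letter-occurs packed 1≤x x≤r
            j , _ , eq′        = value-lookup w z i wi
        in subst (λ y → 1 ≤ y × y ≤ T) (sym (trans eq eq′)) (words-bounds z∈ j)
      map-bounds : ∀ f → f ∈ˡ words T r → ∀ i → 1 ≤ lookup (Vec.map (at f) w) i ×
                                                lookup (Vec.map (at f) w) i ≤ T
      map-bounds f f∈ i =
        let k , eq = at-lookup f (letter≥1 packed i) (lookup≤max w i)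
        in subst (λ y → 1 ≤ y × y ≤ T) (sym (trans (Vec.lookup-map i (at f) w) eq)) (words-bounds f∈ k)

  -- The number of merges.

  mergeLetter-≤ : ∀ {k x} → x ≤ k → mergeLetter k x ≡ x
  mergeLetter-≤ {k} {x} x≤k with x ℕ.≤? k
  ... | yes _  = refl
  ... | no x≰k = contradiction x≤k x≰k

  mergeLetter-> : ∀ {k x} → k < x → mergeLetter k x ≡ pred x
  mergeLetter-> {k} {x} k<x with x ℕ.≤? k
  ... | yes x≤k = contradiction x≤k (<⇒≱ k<x)
  ... | no _    = refl

  mergeLetter-mono : ∀ k {x y} → x ≤ y → mergeLetter k x ≤ mergeLetter k y
  mergeLetter-mono k {x} {y} x≤y with x ℕ.≤? k | y ℕ.≤? k
  ... | yes _   | yes _   = x≤y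
  ... | yes x≤k | no  y≰k = ≤-trans x≤k (pred-mono-≤ (≰⇒> y≰k))
  ... | no  x≰k | yes y≤k = contradiction (≤-trans x≤y y≤k) x≰k
  ... | no  _   | no  _   = pred-mono-≤ x≤y

  max-merge : ∀ {n} k (w : Word n) → max (merge k w) ≡ mergeLetter k (max w)
  max-merge k []      = refl
  max-merge k (x ∷ w) = trans (cong (mergeLetter k x ⊔_) (max-merge k w))
    (sym (mono-≤-distrib-⊔ (mergeLetter-mono k) x (max w)))

  #M-cong : ∀ {M M′ : ℕ → Set} (M? : ∀ k → Dec (M k)) (M′? : ∀ k → Dec (M′ k)) k →
            (∀ {j} → 1 ≤ j → j ≤ k → (M j → M′ j) × (M′ j → M j)) →
            Chains.#M M? k ≡ Chains.#M M′? k
  #M-cong M? M′? zero    eq = refl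
  #M-cong M? M′? (suc k) eq = cong₂ _+_ (#M-cong M? M′? k λ 1≤j j≤k → eq 1≤j (m≤n⇒m≤1+n j≤k))
    (let to , from = eq (s≤s z≤n) ≤-refl in ind-cong (M? (suc k)) (M′? (suc k)) to from)

  module _ {n} (v w : Word n) {k} (occurs : ∃[ m ] lookup w m ≡ suc k)
           (mergeable : Mergeable v w (suc k)) where

    private
      w′ : Word n
      w′ = merge (suc k) w

      w′-lookup : ∀ i → lookup w′ i ≡ mergeLetter (suc k) (lookup w i)
      w′-lookup i = Vec.lookup-map i (mergeLetter (suc k)) w

      merged : ∀ i {y} → lookup w′ i ≡ y → lookup w i ≡ y ⊎ (lookup w i ≡ suc y × suc k ≤ y)
      merged i {y} eq with ≤-<-connex (lookup w i) (suc k)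
      ... | inj₁ le = inj₁ (trans (sym (mergeLetter-≤ le)) (trans (sym (w′-lookup i)) eq))
      ... | inj₂ gt with lookup w i in wi | trans (sym (w′-lookup i)) eq
      ...   | suc x | eq′ = let x≡y = trans (sym (mergeLetter-> gt)) eq′ in
        inj₂ (cong suc x≡y , ≤-trans (s≤s⁻¹ gt) (≤-reflexive x≡y))

      unmerged : ∀ i {y} → lookup w i ≡ y → y ≤ suc k → lookup w′ i ≡ y
      unmerged i refl le = trans (w′-lookup i) (mergeLetter-≤ le)

    -- Merging can only enlarge the blocks up to `suc k`, so the condition after it covers the
    -- condition before.
    mergeable-merge⁻ : ∀ {j} → j ≤ k → Mergeable v w′ j → Mergeable v w j
    mergeable-merge⁻ j≤k m i i′ wi wi′ =
      m i i′ (unmerged i wi (m≤n⇒m≤1+n j≤k)) (unmerged i′ wi′ (s≤s j≤k))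

    -- Only `j = k` needs an argument: the block `suc k` of the merged word also contains the old
    -- block `suc (suc k)`. A position of the old block `suc k`, given by `occurs`, links the two
    -- strict inequalities in `v`.
    mergeable-merge⁺ : ∀ {j} → j ≤ k → Mergeable v w j → Mergeable v w′ j
    mergeable-merge⁺ {j} j≤k m i i′ w′i w′i′ with merged i w′i
    ... | inj₂ (_ , k<j) = contradiction k<j (≤⇒≯ j≤k)
    ... | inj₁ wi with merged i′ w′i′
    ...   | inj₁ wi′ = m i i′ wi wi′
    ...   | inj₂ (wi′ , s≤s k≤j) with ≤-antisym j≤k k≤j
    ...     | refl = let l , wl = occurs in <-trans (m i l wi wl) (mergeable l i′ wl wi′)

  ≤∸1⇒< : ∀ {j m} → 1 ≤ j → j ≤ m ∸ 1 → j < m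
  ≤∸1⇒< {m = zero}  (s≤s _) ()
  ≤∸1⇒< {m = suc m} _       le = s≤s le

  -- The pass runs from right to left, and a merge preserves mergeability and non-mergeability at
  -- all smaller indices. Its decisions are therefore those for the original `w`, and each merge
  -- lowers the maximum by one.
  max-mergeFrom : ∀ {n} k (v w : Word n) → k ≤ max w ∸ 1 →
                  (∀ {x} → 1 ≤ x → x ≤ k → ∃[ i ] lookup w i ≡ x) →
                  max (mergeFrom k v w) + Chains.#M (mergeable? v w) k ≡ max w
  max-mergeFrom zero    v w _  occurs = +-identityʳ (max w)
  max-mergeFrom (suc k) v w le occurs with mergeable? v w (suc k)
  ... | no  _ = trans (cong (max (mergeFrom k v w) +_) (+-identityʳ _))
    (max-mergeFrom k v w (≤-trans (n≤1+n k) le) λ 1≤x x≤k → occurs 1≤x (m≤n⇒m≤1+n x≤k))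
  ... | yes m = begin
    max (mergeFrom k v w′) + (#w + 1)  ≡⟨ +-assoc (max (mergeFrom k v w′)) #w 1 ⟨
    max (mergeFrom k v w′) + #w + 1    ≡⟨ cong (λ s → max (mergeFrom k v w′) + s + 1)
      (#M-cong (mergeable? v w) (mergeable? v w′) k λ _ j≤k →
        mergeable-merge⁺ v w occ m j≤k , mergeable-merge⁻ v w occ m j≤k) ⟩
    max (mergeFrom k v w′) + Chains.#M (mergeable? v w′) k + 1
      ≡⟨ cong (_+ 1) (max-mergeFrom k v w′ k≤ occurs′) ⟩
    max w′ + 1                         ≡⟨ +-comm (max w′) 1 ⟩
    suc (max w′)                       ≡⟨ cong suc maxw′ ⟩
    suc (pred (max w))                 ≡⟨ suc-pred (max w) {{>-nonZero (≤-trans (s≤s z≤n) k<max)}} ⟩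
    max w                              ∎
    where
    w′ = merge (suc k) w
    #w = Chains.#M (mergeable? v w) k
    occ = occurs (s≤s z≤n) ≤-refl
    k<max : suc k < max w
    k<max = ≤∸1⇒< (s≤s z≤n) le
    maxw′ : max w′ ≡ pred (max w)
    maxw′ = trans (max-merge (suc k) w) (mergeLetter-> k<max)
    k≤ : k ≤ max w′ ∸ 1
    k≤ = subst (λ m → k ≤ m ∸ 1) (sym maxw′) (pred-mono-≤ (pred-mono-≤ k<max))
    occurs′ : ∀ {x} → 1 ≤ x → x ≤ k → ∃[ i ] lookup w′ i ≡ x
    occurs′ 1≤x x≤k = let i , wi = occurs 1≤x (m≤n⇒m≤1+n x≤k) in i ,
      trans (Vec.lookup-map i (mergeLetter (suc k)) w)
        (trans (cong (mergeLetter (suc k)) wi) (mergeLetter-≤ (m≤n⇒m≤1+n x≤k)))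

  max-u₀ : ∀ {n} (v w : Word n) → Packed w →
           max (u₀ v w) + Chains.#M (mergeable? v w) (max w ∸ 1) ≡ max w
  max-u₀ v w packed = max-mergeFrom (max w ∸ 1) v w ≤-refl λ 1≤x x≤ →
    letter-occurs packed 1≤x (≤-trans x≤ (m∸n≤m (max w) 1))

  -- Iterated packing and lexicographic comparison of triples.

  infix 4 _≟ʷ_
  _≟ʷ_ : ∀ {n} → DecidableEquality (Word n)
  _≟ʷ_ = Vec.≡-dec ℕ._≟_

  standardize : ∀ {n} → Word n → Word n
  standardize = Packing.packWord <-strictTotalOrder

  Represents-resp : ∀ {n} {w : Word n} {R S : Fin n → Fin n → Set} →
                    (∀ i j → (R i j → S i j) × (S i j → R i j)) → Represents w R → Represents w S
  Represents-resp R⇔S rep = mkRepresents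
    (λ i j → proj₁ (R⇔S i j) ∘ sound rep i j) (λ i j → complete rep i j ∘ proj₂ (R⇔S i j))

  packBiword-represents : ∀ {n} (p q : PackedWord n) →
                          Represents (word (packBiword p q)) (Lex (word p) (word q))
  packBiword-represents p q = Represents-resp
    (λ i j → subst₂ LexPair (zip≡ i) (zip≡ j) , subst₂ LexPair (sym (zip≡ i)) (sym (zip≡ j)))
    (packWord-represents (×-strictTotalOrder <-strictTotalOrder <-strictTotalOrder)
      (Vec.zip (word p) (word q)))
    where
    zip≡ : ∀ i → lookup (Vec.zip (word p) (word q)) i ≡ (lookup (word p) i , lookup (word q) i)
    zip≡ i = Vec.lookup-zip i (word p) (word q)
    LexPair : ℕ × ℕ → ℕ × ℕ → Set
    LexPair (a , b) (a′ , b′) = a < a′ ⊎ (a ≡ a′ × b < b′)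

  #M-none : ∀ {M : ℕ → Set} (M? : ∀ k → Dec (M k)) k → (∀ {j} → 1 ≤ j → j ≤ k → ¬ M j) →
            Chains.#M M? k ≡ 0
  #M-none M? zero    none = refl
  #M-none M? (suc k) none = cong₂ _+_ (#M-none M? k λ 1≤j j≤k → none 1≤j (m≤n⇒m≤1+n j≤k))
                                      (ind-no (M? (suc k)) (none (s≤s z≤n) ≤-refl))

  -- This is `represents-count` with a constant second word: it breaks no tie, so no index is
  -- mergeable and all steps are strict.
  standardize-count : ∀ T {n} {x : Word n} → Packed x →
                      Sum (words T n) (λ z → ind (standardize z ≟ʷ x)) ≡ T C max x
  standardize-count T {n} {x} packed = begin
    Sum (words T n) (λ z → ind (standardize z ≟ʷ x))
      ≡⟨ Sum-cong (words T n) (λ z _ → ind-cong (standardize z ≟ʷ x) (represents? x (lex? z 0s))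
           (λ eq → subst (λ x → Represents x (Lex z 0s)) eq (rep z))
           (λ rep-x → packed-unique (Packing.packWord-packed <-strictTotalOrder z) packed
             (rep z) rep-x)) ⟩
    Sum (words T n) (λ z → ind (represents? x (lex? z 0s)))
      ≡⟨ represents-count 0s packed (λ i j _ → trans (lookup-0s i) (sym (lookup-0s j))) T ⟩
    (T + Chains.#M (mergeable? 0s x) (max x ∸ 1)) C max x
      ≡⟨ cong (λ e → (T + e) C max x) (#M-none (mergeable? 0s x) (max x ∸ 1) none) ⟩
    (T + 0) C max x
      ≡⟨ cong (_C max x) (+-identityʳ T) ⟩
    T C max x ∎
    where
    0s : Word n
    0s = Vec.replicate n 0
    lookup-0s : ∀ i → lookup 0s i ≡ 0
    lookup-0s i = Vec.lookup-replicate i 0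
    0s≮ : ∀ i j → ¬ lookup 0s i < lookup 0s j
    0s≮ i j lt = n≮0 (subst (lookup 0s i <_) (lookup-0s j) lt)
    rep : ∀ z → Represents (standardize z) (Lex z 0s)
    rep z = Represents-resp 
      (λ i j → inj₁ , λ { (inj₁ lt) → lt ; (inj₂ (_ , lt)) → contradiction lt (0s≮ i j) })
      
                            (packWord-represents <-strictTotalOrder z)
    none : ∀ {j} → 1 ≤ j → j ≤ max x ∸ 1 → ¬ Mergeable 0s x j
    none {j} 1≤j j≤ m =
      let j<max    = ≤∸1⇒< 1≤j j≤
          i , xi   = letter-occurs packed 1≤j (<⇒≤ j<max)
          i′ , xi′ = letter-occurs packed (s≤s z≤n) j<max
      in 0s≮ i i′ (m i i′ xi xi′)

  Lex₃ : ∀ {n} → Word n → Word n → Word n → Fin n → Fin n → Set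
  Lex₃ u z v i j = lookup u i < lookup u j ⊎ (lookup u i ≡ lookup u j × Lex z v i j)

  lex₃? : ∀ {n} (u z v : Word n) i j → Dec (Lex₃ u z v i j)
  lex₃? u z v i j = (_ ℕ.<? _) ⊎-dec ((_ ℕ.≟ _) ×-dec lex? z v i j)

  -- A tie in `p` is a tie in both `u` and `x`, and `x` has the same ties and inequalities as `z`.
  -- Hence packing in two stages compares triples.
  Lex-assoc : ∀ {n} (u z v : Word n) {x p q : Word n} → Represents p (Lex u x) →
              Represents x (λ i j → lookup z i < lookup z j) →
              Represents q (Lex p v) → Represents q (Lex₃ u z v)
  Lex-assoc u z v {x} {p} rep-p rep-x = Represents-resp λ i j → to i j , from i j
    where
    to : ∀ i j → Lex p v i j → Lex₃ u z v i j
    to i j (inj₁ lt) with sound rep-p i j lt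
    ... | inj₁ u<        = inj₁ u<
    ... | inj₂ (u≡ , x<) = inj₂ (u≡ , inj₁ (sound rep-x i j x<))
    to i j (inj₂ (p≡ , v<)) =
      let u≡ , x≡ = ¬Lex⇒≡ u x (tie⇒¬ rep-p p≡) (tie⇒¬ rep-p (sym p≡))
      in inj₂ (u≡ , inj₂ (≤-antisym (≮⇒≥ (tie⇒¬ rep-x (sym x≡))) (≮⇒≥ (tie⇒¬ rep-x x≡)) , v<))
    from : ∀ i j → Lex₃ u z v i j → Lex p v i j
    from i j (inj₁ u<)                    = inj₁ (complete rep-p i j (inj₁ u<))
    from i j (inj₂ (u≡ , inj₁ z<))        =
      inj₁ (complete rep-p i j (inj₂ (u≡ , complete rep-x i j z<)))
    from i j (inj₂ (u≡ , inj₂ (z≡ , v<))) = inj₂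
      (¬⇒tie rep-p (Lex-irrefl u x u≡ x≡) (Lex-irrefl u x (sym u≡) (sym x≡)) , v<)
      where x≡ = ¬⇒tie rep-x (λ lt → <⇒≢ lt z≡) (λ lt → <⇒≢ lt (sym z≡))

  Represents⇒finer : ∀ {n} (u z v : Word n) {w : Word n} → Represents w (Lex₃ u z v) → ∀ i j →
                     lookup w i ≤ lookup w j → lookup u i ≤ lookup u j
  Represents⇒finer u z v rep i j w≤ = ≮⇒≥ λ u> → ≤⇒≯ w≤ (complete rep j i (inj₁ u>))

  -- Equal letters of `w` exclude a strict comparison of the triples in either direction, which
  -- forces a tie in `u`, and then in `z` and `v`.
  Represents⇒weaklyFiner : ∀ {n} (u z v : Word n) {w : Word n} → Represents w (Lex₃ u z v) → ∀ i j →
                           lookup w i ≡ lookup w j → lookup v i ≡ lookup v j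
  Represents⇒weaklyFiner u z v rep i j w≡ =
    proj₂ (¬Lex⇒≡ z v (λ l → ¬ij (inj₂ (u≡ , l))) (λ l → ¬ji (inj₂ (sym u≡ , l))))
    where
    ¬ij = tie⇒¬ rep w≡
    ¬ji = tie⇒¬ rep (sym w≡)
    u≡ : lookup u i ≡ lookup u j
    u≡ = ≤-antisym (≮⇒≥ (¬ji ∘ inj₁)) (≮⇒≥ (¬ij ∘ inj₁))

  -- Restriction to the positions of one letter of `u`.

  module Block {n} (u v w : Word n) {c} {vc wc : Word (#[ u ] c)}
    (rep-v : Represents vc (λ k l → lookup (subword u c v) k < lookup (subword u c v) l))
    (rep-w : Represents wc (λ k l → lookup (subword u c w) k < lookup (subword u c w) l)) where

    block-weaklyFiner : (∀ i j → lookup w i ≡ lookup w j → lookup v i ≡ lookup v j) →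
                        ∀ k l → lookup wc k ≡ lookup wc l → lookup vc k ≡ lookup vc l
    block-weaklyFiner weak k l eq =
      let i , _ , hi = subword-lookup⁻ u c k
          j , _ , hj = subword-lookup⁻ u c l
          sw≡ = ≤-antisym (≮⇒≥ (tie⇒¬ rep-w (sym eq))) (≮⇒≥ (tie⇒¬ rep-w eq))
          sv≡ = trans (hi v) (trans (weak i j (trans (sym (hi w)) (trans sw≡ (hj w)))) (sym (hj v)))
      in ¬⇒tie rep-v (λ lt → <⇒≢ lt sv≡) (λ lt → <⇒≢ lt (sym sv≡))

    module _ {k l i j} (hk : ∀ y → lookup (subword u c y) k ≡ lookup y i)
                       (hl : ∀ y → lookup (subword u c y) l ≡ lookup y j) where

      lex⁻ : ∀ z → Lex (subword u c z) vc k l → Lex z v i j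
      lex⁻ z (inj₁ lt)        = inj₁ (subst₂ _<_ (hk z) (hl z) lt)
      lex⁻ z (inj₂ (eq , lt)) = inj₂ (trans (sym (hk z)) (trans eq (hl z)) ,
        subst₂ _<_ (hk v) (hl v) (sound rep-v k l lt))

      lex⁺ : ∀ z → Lex z v i j → Lex (subword u c z) vc k l
      lex⁺ z (inj₁ lt)        = inj₁ (subst₂ _<_ (sym (hk z)) (sym (hl z)) lt)
      lex⁺ z (inj₂ (eq , lt)) = inj₂ (trans (hk z) (trans eq (sym (hl z))) ,
        complete rep-v k l (subst₂ _<_ (sym (hk v)) (sym (hl v)) lt))

      <⁻ : lookup wc k < lookup wc l → lookup w i < lookup w j
      <⁻ lt = subst₂ _<_ (hk w) (hl w) (sound rep-w k l lt)

      <⁺ : lookup w i < lookup w j → lookup wc k < lookup wc l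
      <⁺ lt = complete rep-w k l (subst₂ _<_ (sym (hk w)) (sym (hl w)) lt)

    -- On these positions `u` is constant, so the first component of `Lex₃` never decides.
    restrict : ∀ z → Represents w (Lex₃ u z v) → Represents wc (Lex (subword u c z) vc)
    restrict z rep = mkRepresents to from
      where
      same-u : ∀ {i j} → lookup u i ≡ lookup u j → Lex₃ u z v i j → Lex z v i j
      same-u u≡ (inj₁ u<)      = contradiction u≡ (<⇒≢ u<)
      same-u u≡ (inj₂ (_ , l)) = l
      to : ∀ k l → lookup wc k < lookup wc l → Lex (subword u c z) vc k l
      to k l lt =
        let i , ui , hi = subword-lookup⁻ u c k
            j , uj , hj = subword-lookup⁻ u c l
        in lex⁺ hi hj z (same-u (trans ui (sym uj)) (sound rep i j (<⁻ hi hj lt)))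
      from : ∀ k l → Lex (subword u c z) vc k l → lookup wc k < lookup wc l
      from k l lex =
        let i , ui , hi = subword-lookup⁻ u c k
            j , uj , hj = subword-lookup⁻ u c l
        in <⁺ hi hj (complete rep i j (inj₂ (trans ui (sym uj) , lex⁻ hi hj z lex)))

    module _ {i j} (ui : lookup u i ≡ c) (uj : lookup u j ≡ c) (z : Word n)
             (rep : Represents wc (Lex (subword u c z) vc)) where

      private
        k = proj₁ (subword-lookup⁺ u i ui)
        l = proj₁ (subword-lookup⁺ u j uj)
        hk = proj₂ (subword-lookup⁺ u i ui)
        hl = proj₂ (subword-lookup⁺ u j uj)

      extend-sound : lookup w i < lookup w j → Lex z v i j
      extend-sound lt = lex⁻ hk hl z (sound rep k l (<⁺ hk hl lt))

      extend-complete : Lex z v i j → lookup w i < lookup w j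
      extend-complete lex = <⁻ hk hl (complete rep k l (lex⁺ hk hl z lex))

  -- The coefficient of a basis element at a natural number.

  packedWord-occurs : ∀ {n} (x : PackedWord n) → ∃[ y ] y ∈ˡ packedWords n × word y ≡ word x
  packedWord-occurs x with ∈ˡ.∈-map⁻ word (packedWords-complete x)
  ... | y , y∈ , eq = y , y∈ , sym eq

  inW? : ∀ {n} (u v w : PackedWord n) → Dec (w FinerThan u × w WeaklyFinerThan v)
  inW? u v w = finerThan? w u ×-dec weaklyFinerThan? w v

  module _ {n} (u v w : PackedWord n) where

    -- The summand of the left-hand side at x counts, by standardize-count, the words z
    -- over {1,…,T} with pack(z) = x for which pack(u, x, v) = w.
    represents-sum : ∀ T →
      Sum (packedWords n) (λ x → ind (word (packBiword (packBiword u x) v) ≟ʷ word w) *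
                                 (T C max (word x))) ≡
      Sum (words T n) (λ z → ind (represents? (word w) (lex₃? (word u) z (word v))))
    represents-sum T = begin
      Sum (packedWords n) (λ x → hit x * (T C max (word x)))
        ≡⟨ Sum-cong (packedWords n) (λ x _ → trans
             (cong (hit x *_) (sym (standardize-count T (packed x))))
             (sym (Sum-*ˡ (hit x) (words T n) _))) ⟩
      Sum (packedWords n) (λ x → Sum (words T n) λ z → hit x * ind (standardize z ≟ʷ word x))
        ≡⟨ Sum-swap (packedWords n) (words T n) _ ⟩
      Sum (words T n) (λ z → Sum (packedWords n) λ x → hit x * ind (standardize z ≟ʷ word x))
        ≡⟨ Sum-cong (words T n) (λ z _ → select z) ⟩
      Sum (words T n) (λ z → ind (represents? (word w) (lex₃? (word u) z (word v)))) ∎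
      where
      hit : PackedWord n → ℕ
      hit x = ind (word (packBiword (packBiword u x) v) ≟ʷ word w)
      select : ∀ z → Sum (packedWords n) (λ x → hit x * ind (standardize z ≟ʷ word x)) ≡
                     ind (represents? (word w) (lex₃? (word u) z (word v)))
      select z = let x , x∈ , x≡ = packedWord-occurs (pack <-strictTotalOrder z)
                     rep         = Lex-assoc (word u) z (word v) (packBiword-represents u x)
                         (subst (λ x → Represents x (λ i j → lookup z i < lookup z j)) (sym x≡)
                           (packWord-represents <-strictTotalOrder z))
                         (packBiword-represents (packBiword u x) v) in begin
        Sum (packedWords n) (λ y → hit y * ind (standardize z ≟ʷ word y))
          ≡⟨ Sum-cong (packedWords n) (λ y _ → trans (*-comm (hit y) _) (cong (_* hit y)
               (ind-cong (standardize z ≟ʷ word y) (word y ≟ʷ word x)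
                 (λ eq → sym (trans x≡ eq)) (λ eq → sym (trans eq x≡))))) ⟩
        Sum (packedWords n) (λ y → ind (word y ≟ʷ word x) * hit y)
          ≡⟨ Sum-δ _≟ʷ_ word hit (packedWords-unique n) x∈ ⟩
        hit x
          ≡⟨ ind-cong _ (represents? (word w) (lex₃? (word u) z (word v)))
               (λ eq → subst (λ w → Represents w (Lex₃ (word u) z (word v))) eq rep)
               (packed-unique (packed (packBiword (packBiword u x) v)) (packed w) rep) ⟩
        ind (represents? (word w) (lex₃? (word u) z (word v))) ∎

    private
      vᶜ wᶜ : ∀ c → Word (#[ word u ] c)
      vᶜ c = word (v ∣[ u ] c)
      wᶜ c = word (w ∣[ u ] c)

      module B c = Block (word u) (word v) (word w)
        (packWord-represents <-strictTotalOrder (subword (word u) c (word v)))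
        (packWord-represents <-strictTotalOrder (subword (word u) c (word w)))

    -- Fineness makes `w` follow `u` on positions with different letters in `u`. Positions with the
    -- same letter lie in one block, where `blocks` decides.
    glue : w FinerThan u → ∀ z →
           (∀ c → 1 ≤ c → c ≤ max (word u) → Represents (wᶜ c) (Lex (subword (word u) c z) (vᶜ c))) →
           Represents (word w) (Lex₃ (word u) z (word v))
    glue finer z blocks = mkRepresents to from
      where
      block : ∀ i → Represents (wᶜ (lookup (word u) i))
                      (Lex (subword (word u) (lookup (word u) i) z) (vᶜ (lookup (word u) i)))
      block i = blocks (lookup (word u) i) (letter≥1 (packed u) i) (lookup≤max (word u) i)
      to : ∀ i j → lookup (word w) i < lookup (word w) j → Lex₃ (word u) z (word v) i j
      to i j w< with m≤n⇒m<n∨m≡n (finer i j (<⇒≤ w<))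
      ... | inj₁ u< = inj₁ u<
      ... | inj₂ u≡ = inj₂ (u≡ , B.extend-sound (lookup (word u) i) refl (sym u≡) z (block i) w<)
      from : ∀ i j → Lex₃ (word u) z (word v) i j → lookup (word w) i < lookup (word w) j
      from i j (inj₁ u<)         = ≰⇒> λ w≥ → <⇒≱ u< (finer j i w≥)
      from i j (inj₂ (u≡ , lex)) =
        B.extend-complete (lookup (word u) i) refl (sym u≡) z (block i) lex

    blockLength blockMerges : ℕ → ℕ
    blockLength c = max (word (w ∣[ u ] c))
    blockMerges c = Chains.#M (mergeable? (word (v ∣[ u ] c)) (word (w ∣[ u ] c))) (blockLength c ∸ 1)

    weightAt : ℕ → ℕ
    weightAt T = Prod (max (word u)) (λ c → (T + blockMerges c) C blockLength c)

    packBiword-count : ∀ T →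
      Sum (packedWords n) (λ x → ind (word (packBiword (packBiword u x) v) ≟ʷ word w) *
                                 (T C max (word x))) ≡
      ind (inW? u v w) * weightAt T
    packBiword-count T with inW? u v w
    ... | no ∉W = trans (represents-sum T) (Sum-zero (words T n) λ z _ →
      ind-no (represents? (word w) (lex₃? (word u) z (word v))) (λ rep → ∉W
        (Represents⇒finer (word u) z (word v) rep , Represents⇒weaklyFiner (word u) z (word v) rep)))
    ... | yes (finer , weak) = begin
      _ ≡⟨ represents-sum T ⟩
      Sum (words T n) (λ z → ind (represents? (word w) (lex₃? (word u) z (word v))))
        ≡⟨ Sum-cong (words T n) (λ z _ → ind-Prod (max (word u))
             (represents? (word w) (lex₃? (word u) z (word v)))
             (λ c → block? c (subword (word u) c z))
             (λ rep c _ _ → B.restrict c z rep)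
             (glue finer z)) ⟩
      Sum (words T n) (λ z → Prod (max (word u)) λ c → ind (block? c (subword (word u) c z)))
        ≡⟨ Sum-Prod-subword T (max (word u)) (word u)
             (λ i → letter≥1 (packed u) i , lookup≤max (word u) i) (λ c z → ind (block? c z)) ⟩
      Prod (max (word u)) (λ c → Sum (words T (#[ word u ] c)) λ z → ind (block? c z))
        ≡⟨ Prod-cong (max (word u)) (λ c _ _ →
             represents-count (vᶜ c) (packed (w ∣[ u ] c)) (B.block-weaklyFiner c weak) T) ⟩
      Prod (max (word u)) (λ c → (T + blockMerges c) C blockLength c)
        ≡⟨ +-identityʳ _ ⟨
      _ ∎
      where
      block? : ∀ c (z : Word (#[ word u ] c)) →
               Dec (Represents (word (w ∣[ u ] c)) (Lex z (word (v ∣[ u ] c))))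
      block? c z = represents? (word (w ∣[ u ] c)) (lex? z (word (v ∣[ u ] c)))

  Sum-W : ∀ {n} (u v w : PackedWord n) T →
          Sum (W u v) (λ x → ind (word x ≟ʷ word w) * weightAt u v x T) ≡
          ind (inW? u v w) * weightAt u v w T
  Sum-W {n} u v w T with packedWord-occurs w
  -- `y` and `w` share their word, and only the word enters `inW?` and `weightAt`; passing from `w`
  -- to the listed `y` is therefore definitional.
  ... | y , y∈ , refl = begin
    Sum (W u v) (λ x → ind (word x ≟ʷ word y) * weightAt u v x T)
      ≡⟨ Sum-filter (inW? u v) (packedWords n) _ ⟩
    Sum (packedWords n) (λ x → ind (inW? u v x) * (ind (word x ≟ʷ word y) * weightAt u v x T))
      ≡⟨ Sum-cong (packedWords n) (λ x _ →
           x∙yz≈y∙xz (ind (inW? u v x)) (ind (word x ≟ʷ word y)) (weightAt u v x T)) ⟩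
    Sum (packedWords n) (λ x → ind (word x ≟ʷ word y) * (ind (inW? u v x) * weightAt u v x T))
      ≡⟨ Sum-δ _≟ʷ_ word (λ x → ind (inW? u v x) * weightAt u v x T) (packedWords-unique n) y∈ ⟩
    ind (inW? u v y) * weightAt u v y T ∎

-- Binomial identities without subtraction.

open Counting

-- The identity (k + 1) C(n, k + 1) = (n - k) C(n, k) with the negative term moved to the left, so
-- that no truncated subtraction appears. Pascal's rule carries the induction on `n`.
absorption : ∀ n k → suc k ℕ.* (n C suc k) ℕ.+ k ℕ.* (n C k) ≡ n ℕ.* (n C k)
absorption zero    zero    = ≡.refl
absorption zero    (suc k) = ≡.cong₂ ℕ._+_ (ℕ.*-zeroʳ k) (ℕ.*-zeroʳ k)
absorption (suc n) zero    = ≡.trans (ℕ.+-identityʳ _) (≡.trans (ℕ.+-identityʳ _)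
  (≡.trans (nC1≡n (suc n)) (≡.sym (ℕ.*-identityʳ (suc n)))))
absorption (suc n) (suc k) = begin
  suc (suc k) ℕ.* (suc n C suc (suc k)) ℕ.+ suc k ℕ.* (suc n C suc k)
    ≡⟨ ≡.cong₂ (λ x y → suc (suc k) ℕ.* x ℕ.+ suc k ℕ.* y)
         (nCk+nC[k+1]≡[n+1]C[k+1] n (suc k)) (nCk+nC[k+1]≡[n+1]C[k+1] n k) ⟨
  suc (suc k) ℕ.* (b ℕ.+ c) ℕ.+ suc k ℕ.* (a ℕ.+ b)
    ≡⟨ solve 4 (λ k a b c → (con 2 :+ k) :* (b :+ c) :+ (con 1 :+ k) :* (a :+ b) :=
         ((con 2 :+ k) :* c :+ (con 1 :+ k) :* b) :+ ((con 1 :+ k) :* b :+ k :* a) :+ (a :+ b))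
         ≡.refl k a b c ⟩
  (suc (suc k) ℕ.* c ℕ.+ suc k ℕ.* b) ℕ.+ (suc k ℕ.* b ℕ.+ k ℕ.* a) ℕ.+ (a ℕ.+ b)
    ≡⟨ ≡.cong₂ (λ x y → x ℕ.+ y ℕ.+ (a ℕ.+ b)) (absorption n (suc k)) (absorption n k) ⟩
  n ℕ.* b ℕ.+ n ℕ.* a ℕ.+ (a ℕ.+ b)
    ≡⟨ solve 3 (λ n a b → n :* b :+ n :* a :+ (a :+ b) := (con 1 :+ n) :* (a :+ b)) ≡.refl n a b ⟩
  suc n ℕ.* (a ℕ.+ b)
    ≡⟨ ≡.cong (suc n ℕ.*_) (nCk+nC[k+1]≡[n+1]C[k+1] n k) ⟩
  suc n ℕ.* (suc n C suc k) ∎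
  where
  open ≡.≡-Reasoning
  open Data.Nat.Solver.+-*-Solver
  a = n C k
  b = n C suc k
  c = n C suc (suc k)

-- With k! C(n, k) = n(n - 1)...(n - k + 1), this is the recursion of falling factorials, whose new
-- factor is n - k, in the same additive form.
falling : ∀ n k → suc k ! ℕ.* (n C suc k) ℕ.+ k ! ℕ.* (n C k) ℕ.* k ≡ k ! ℕ.* (n C k) ℕ.* n
falling n k = begin
  suc k ! ℕ.* (n C suc k) ℕ.+ k ! ℕ.* (n C k) ℕ.* k
    ≡⟨ solve 4 (λ k f a b → ((con 1 :+ k) :* f) :* b :+ f :* a :* k :=
                            f :* ((con 1 :+ k) :* b :+ k :* a)) ≡.refl k (k !) (n C k) (n C suc k) ⟩
  k ! ℕ.* (suc k ℕ.* (n C suc k) ℕ.+ k ℕ.* (n C k))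
    ≡⟨ ≡.cong (k ! ℕ.*_) (absorption n k) ⟩
  k ! ℕ.* (n ℕ.* (n C k))
    ≡⟨ solve 3 (λ n f a → f :* (n :* a) := f :* a :* n) ≡.refl n (k !) (n C k) ⟩
  k ! ℕ.* (n C k) ℕ.* n ∎
  where
  open ≡.≡-Reasoning
  open Data.Nat.Solver.+-*-Solver

module _ {c ℓ} (K : Field c ℓ) (char0 : CharacteristicZero K) where

  open Field K
  open WQSym K char0
  open Algebra.Properties.Group +-group using () renaming (∙-cancelʳ to +-cancelʳ)
  open Algebra.Properties.Ring ring using (-1*x≈-x)
  open Algebra.Properties.Semiring.Mult semiring using (×-homo-+; ×1-homo-*; ×-congˡ)
  open Algebra.Solver.Ring.NaturalCoefficients.Default commutativeSemiring using (solve; _:=_; _:+_; _:*_)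
  open Relation.Binary.Reasoning.Setoid setoid

  -- Evaluation of polynomials.

  ⟦⟧-+ : ∀ m n → ⟦ m ℕ.+ n ⟧ ≈ ⟦ m ⟧ + ⟦ n ⟧
  ⟦⟧-+ = ×-homo-+ 1#

  ⟦⟧-* : ∀ m n → ⟦ m ℕ.* n ⟧ ≈ ⟦ m ⟧ * ⟦ n ⟧
  ⟦⟧-* = ×1-homo-*

  ⟦⟧-cong : ∀ {m n} → m ≡ n → ⟦ m ⟧ ≈ ⟦ n ⟧
  ⟦⟧-cong = ×-congˡ {1#}

  eval : K[t] → Carrier → Carrier
  eval []      x = 0#
  eval (a ∷ p) x = a + x * eval p x

  eval-+ᴾ : ∀ p q x → eval (p +ᴾ q) x ≈ eval p x + eval q x
  eval-+ᴾ []      q       x = sym (+-identityˡ _)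
  eval-+ᴾ (a ∷ p) []      x = sym (+-identityʳ _)
  eval-+ᴾ (a ∷ p) (b ∷ q) x = begin
    a + b + x * eval (p +ᴾ q) x                ≈⟨ +-congˡ (*-congˡ (eval-+ᴾ p q x)) ⟩
    a + b + x * (eval p x + eval q x)          ≈⟨ solve 5 (λ a b x p q →
      a :+ b :+ x :* (p :+ q) := (a :+ x :* p) :+ (b :+ x :* q)) refl a b x _ _ ⟩
    (a + x * eval p x) + (b + x * eval q x)    ∎

  eval-scale : ∀ a p x → eval (scale a p) x ≈ a * eval p x
  eval-scale a []      x = sym (zeroʳ a)
  eval-scale a (b ∷ p) x = begin
    a * b + x * eval (scale a p) x  ≈⟨ +-congˡ (*-congˡ (eval-scale a p x)) ⟩
    a * b + x * (a * eval p x)      ≈⟨ solve 4 (λ a b x p →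
      a :* b :+ x :* (a :* p) := a :* (b :+ x :* p)) refl a b x _ ⟩
    a * (b + x * eval p x)          ∎

  eval-*ᴾ : ∀ p q x → eval (p *ᴾ q) x ≈ eval p x * eval q x
  eval-*ᴾ []      q x = sym (zeroˡ _)
  eval-*ᴾ (a ∷ p) q x = begin
    eval (scale a q +ᴾ (0# ∷ (p *ᴾ q))) x            ≈⟨ eval-+ᴾ (scale a q) _ x ⟩
    eval (scale a q) x + (0# + x * eval (p *ᴾ q) x)  ≈⟨ +-cong (eval-scale a q x)
      (trans (+-identityˡ _) (*-congˡ (eval-*ᴾ p q x))) ⟩
    a * eval q x + x * (eval p x * eval q x)         ≈⟨ solve 4 (λ a x p q →
      a :* q :+ x :* (p :* q) := (a :+ x :* p) :* q) refl a x _ _ ⟩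
    (a + x * eval p x) * eval q x                    ∎

  eval-1ᴾ : ∀ x → eval 1ᴾ x ≈ 1#
  eval-1ᴾ x = trans (+-congˡ (zeroʳ x)) (+-identityʳ 1#)

  eval-∏ : ∀ r (f : ℕ → K[t]) (F : ℕ → ℕ) x → (∀ i → eval (f i) x ≈ ⟦ F i ⟧) →
           eval (∏[1… r ] f) x ≈ ⟦ Prod r F ⟧
  eval-∏ zero    f F x eq = trans (eval-1ᴾ x) (sym (+-identityʳ 1#))
  eval-∏ (suc r) f F x eq = begin
    eval (∏[1… r ] f *ᴾ f (suc r)) x          ≈⟨ eval-*ᴾ (∏[1… r ] f) (f (suc r)) x ⟩
    eval (∏[1… r ] f) x * eval (f (suc r)) x  ≈⟨ *-cong (eval-∏ r f F x eq) (eq (suc r)) ⟩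
    ⟦ Prod r F ⟧ * ⟦ F (suc r) ⟧              ≈⟨ ⟦⟧-* (Prod r F) (F (suc r)) ⟨
    ⟦ Prod (suc r) F ⟧                        ∎

  -- Polynomials that vanish at all natural numbers.

  coeff-+ᴾ : ∀ p q k → coeff (p +ᴾ q) k ≈ coeff p k + coeff q k
  coeff-+ᴾ []      q       k       = sym (+-identityˡ _)
  coeff-+ᴾ (a ∷ p) []      k       = sym (+-identityʳ _)
  coeff-+ᴾ (a ∷ p) (b ∷ q) zero    = refl
  coeff-+ᴾ (a ∷ p) (b ∷ q) (suc k) = coeff-+ᴾ p q k

  coeff-scale : ∀ a p k → coeff (scale a p) k ≈ a * coeff p k
  coeff-scale a []      k       = sym (zeroʳ a)
  coeff-scale a (b ∷ p) zero    = refl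
  coeff-scale a (b ∷ p) (suc k) = coeff-scale a p k

  -- Synthetic division of p by t - y.
  quotient : Carrier → K[t] → K[t]
  quotient y []          = []
  quotient y (a ∷ [])    = []
  quotient y (a ∷ b ∷ p) = eval (b ∷ p) y ∷ quotient y (b ∷ p)

  -- Writing the point as `y + d` puts p(y + d) = p(y) + d q(y + d) in a form free of subtraction,
  -- within reach of the commutative semiring solver.
  eval-quotient : ∀ y d p → eval p (y + d) ≈ eval p y + d * eval (quotient y p) (y + d)
  eval-quotient y d []          = sym (trans (+-identityˡ _) (zeroʳ d))
  eval-quotient y d (a ∷ [])    = begin
    a + (y + d) * 0#              ≈⟨ +-congˡ (trans (zeroʳ _) (sym (zeroʳ y))) ⟩
    a + y * 0#                    ≈⟨ +-identityʳ _ ⟨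
    a + y * 0# + 0#               ≈⟨ +-congˡ (zeroʳ d) ⟨
    a + y * 0# + d * 0#           ∎
  eval-quotient y d (a ∷ b ∷ p) = begin
    a + (y + d) * eval (b ∷ p) (y + d)        ≈⟨ +-congˡ (*-congˡ (eval-quotient y d (b ∷ p))) ⟩
    a + (y + d) * (e + d * q)                 ≈⟨ solve 5 (λ a y d e q →
      a :+ (y :+ d) :* (e :+ d :* q) := (a :+ y :* e) :+ d :* (e :+ (y :+ d) :* q)) refl a y d e q ⟩
    (a + y * e) + d * (e + (y + d) * q)       ∎
    where
    e = eval (b ∷ p) y
    q = eval (quotient y (b ∷ p)) (y + d)

  -- The head of the quotient is the value at `y` of the tail of `p`; its vanishing is the root
  -- hypothesis of the recursive call on that tail.
  vanishing-quotient : ∀ y p → eval p y ≈ 0# → (∀ k → coeff (quotient y p) k ≈ 0#) →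
                       ∀ k → coeff p k ≈ 0#
  vanishing-quotient y []          p≈0 q≈0 k       = refl
  vanishing-quotient y (a ∷ [])    p≈0 q≈0 zero    =
    trans (sym (trans (+-congˡ (zeroʳ y)) (+-identityʳ a))) p≈0
  vanishing-quotient y (a ∷ [])    p≈0 q≈0 (suc k) = refl
  vanishing-quotient y (a ∷ b ∷ p) p≈0 q≈0 zero    =
    trans (sym (trans (+-congˡ (trans (*-congˡ (q≈0 0)) (zeroʳ y))) (+-identityʳ a))) p≈0
  vanishing-quotient y (a ∷ b ∷ p) p≈0 q≈0 (suc k) =
    vanishing-quotient y (b ∷ p) (q≈0 0) (q≈0 ∘ suc) k

  length-quotient : ∀ y a p → List.length (quotient y (a ∷ p)) ≡ List.length p
  length-quotient y a []      = ≡.refl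
  length-quotient y a (b ∷ p) = ≡.cong suc (length-quotient y b p)

  *-cancel-nonzero : ∀ {x y} → ¬ x ≈ 0# → x * y ≈ 0# → y ≈ 0#
  *-cancel-nonzero {x} {y} x≉0 xy≈0 = let x⁻¹ , x*x⁻¹ = inverse x x≉0 in begin
    y              ≈⟨ *-identityˡ y ⟨
    1# * y         ≈⟨ *-congʳ (trans (*-comm x⁻¹ x) x*x⁻¹) ⟨
    x⁻¹ * x * y    ≈⟨ *-assoc x⁻¹ x y ⟩
    x⁻¹ * (x * y)  ≈⟨ *-congˡ xy≈0 ⟩
    x⁻¹ * 0#       ≈⟨ zeroʳ x⁻¹ ⟩
    0#             ∎

  -- Division by t - m uses up the root `⟦ m ⟧`. At m + d + 1 the divisor takes the value
  -- `⟦ suc d ⟧`, nonzero in characteristic 0, so the quotient vanishes at m + 1, m + 2, ... and is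
  -- one entry shorter; `n` bounds the recursion.
  vanishing : ∀ n p → List.length p ≤ n → ∀ m → (∀ d → eval p ⟦ m ℕ.+ d ⟧ ≈ 0#) →
              ∀ k → coeff p k ≈ 0#
  vanishing n       []      _       m p≈0 = λ _ → refl
  vanishing (suc n) (a ∷ p) (s≤s le) m p≈0 =
    vanishing-quotient ⟦ m ⟧ (a ∷ p) root
      (vanishing n (quotient ⟦ m ⟧ (a ∷ p)) (≡.subst (_≤ n) (≡.sym (length-quotient ⟦ m ⟧ a p)) le)
        (suc m) quotient-vanishes)
    where
    root : eval (a ∷ p) ⟦ m ⟧ ≈ 0#
    root = ≡.subst (λ m → eval (a ∷ p) ⟦ m ⟧ ≈ 0#) (ℕ.+-identityʳ m) (p≈0 0)
    eval-cong : ∀ p {x y} → x ≈ y → eval p x ≈ eval p y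
    eval-cong []      x≈y = refl
    eval-cong (a ∷ p) x≈y = +-congˡ (*-cong x≈y (eval-cong p x≈y))
    quotient-vanishes : ∀ d → eval (quotient ⟦ m ⟧ (a ∷ p)) ⟦ suc m ℕ.+ d ⟧ ≈ 0#
    quotient-vanishes d = *-cancel-nonzero (char0 (suc d)) (begin
      ⟦ suc d ⟧ * eval q ⟦ suc m ℕ.+ d ⟧
        ≈⟨ *-congˡ (eval-cong q x≈) ⟩
      ⟦ suc d ⟧ * eval q (⟦ m ⟧ + ⟦ suc d ⟧)
        ≈⟨ trans (+-congʳ root) (+-identityˡ _) ⟨
      eval (a ∷ p) ⟦ m ⟧ + ⟦ suc d ⟧ * eval q (⟦ m ⟧ + ⟦ suc d ⟧)
        ≈⟨ eval-quotient ⟦ m ⟧ ⟦ suc d ⟧ (a ∷ p) ⟨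
      eval (a ∷ p) (⟦ m ⟧ + ⟦ suc d ⟧)
        ≈⟨ eval-cong (a ∷ p) (⟦⟧-+ m (suc d)) ⟨
      eval (a ∷ p) ⟦ m ℕ.+ suc d ⟧
        ≈⟨ p≈0 (suc d) ⟩
      0# ∎)
      where
      q  = quotient ⟦ m ⟧ (a ∷ p)
      x≈ : ⟦ suc m ℕ.+ d ⟧ ≈ ⟦ m ⟧ + ⟦ suc d ⟧
      x≈ = trans (⟦⟧-cong (≡.sym (ℕ.+-suc m d))) (⟦⟧-+ m (suc d))

  interpolation : ∀ p q → (∀ T → eval p ⟦ T ⟧ ≈ eval q ⟦ T ⟧) → p ≈ᴾ q
  interpolation p q p≈q k = +-cancelʳ (- coeff q k) _ _ (begin
    coeff p k - coeff q k            ≈⟨ +-congˡ (-1*x≈-x (coeff q k)) ⟨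
    coeff p k + - 1# * coeff q k     ≈⟨ trans (coeff-+ᴾ p _ k) (+-congˡ (coeff-scale (- 1#) q k)) ⟨
    coeff (p +ᴾ scale (- 1#) q) k    ≈⟨ vanishing _ (p +ᴾ scale (- 1#) q) ℕ.≤-refl 0 difference k ⟩
    0#                               ≈⟨ -‿inverseʳ (coeff q k) ⟨
    coeff q k - coeff q k            ∎)
    where
    difference : ∀ T → eval (p +ᴾ scale (- 1#) q) ⟦ T ⟧ ≈ 0#
    difference T = begin
      eval (p +ᴾ scale (- 1#) q) ⟦ T ⟧       ≈⟨ eval-+ᴾ p _ ⟦ T ⟧ ⟩
      eval p ⟦ T ⟧ + eval (scale (- 1#) q) ⟦ T ⟧
        ≈⟨ +-cong (p≈q T) (trans (eval-scale (- 1#) q ⟦ T ⟧) (-1*x≈-x _)) ⟩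
      eval q ⟦ T ⟧ - eval q ⟦ T ⟧            ≈⟨ -‿inverseʳ _ ⟩
      0#                                     ∎

  -- Values of the binomial polynomials.

  module _ (a : Carrier) (T N : ℕ) (T+a : ⟦ T ⟧ + a ≈ ⟦ N ⟧) where

    -- `⟦ m ⟧` stays on the left because `N ∸ m` would be truncated for `m > N`.
    eval-linear : ∀ m → eval (t+ (a - ⟦ m ⟧)) ⟦ T ⟧ + ⟦ m ⟧ ≈ ⟦ N ⟧
    eval-linear m = begin
      a - ⟦ m ⟧ + ⟦ T ⟧ * (1# + ⟦ T ⟧ * 0#) + ⟦ m ⟧
        ≈⟨ +-congʳ (+-congˡ (trans (*-congˡ (eval-1ᴾ ⟦ T ⟧)) (*-identityʳ ⟦ T ⟧))) ⟩
      a - ⟦ m ⟧ + ⟦ T ⟧ + ⟦ m ⟧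
        ≈⟨ solve 4 (λ a m n T → a :+ n :+ T :+ m := T :+ a :+ (n :+ m)) refl a ⟦ m ⟧ (- ⟦ m ⟧) ⟦ T ⟧ ⟩
      ⟦ T ⟧ + a + (- ⟦ m ⟧ + ⟦ m ⟧)
        ≈⟨ +-cong T+a (-‿inverseˡ ⟦ m ⟧) ⟩
      ⟦ N ⟧ + 0#
        ≈⟨ +-identityʳ ⟦ N ⟧ ⟩
      ⟦ N ⟧ ∎

    eval-falling : ∀ m → eval (∏[1… m ] λ i → t+ (a - ⟦ i ∸ 1 ⟧)) ⟦ T ⟧ ≈ ⟦ m ! ℕ.* (N C m) ⟧
    eval-falling zero    = trans (eval-1ᴾ ⟦ T ⟧) (sym (+-identityʳ 1#))
    -- Adding `⟦ f ℕ.* m ⟧` to both sides turns the factor N - m into `N`, which is the form of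
    -- `falling`.
    eval-falling (suc m) = +-cancelʳ ⟦ f ℕ.* m ⟧ _ _ (begin
      eval (P *ᴾ t+ (a - ⟦ m ⟧)) ⟦ T ⟧ + ⟦ f ℕ.* m ⟧
        ≈⟨ +-cong (trans (eval-*ᴾ P (t+ (a - ⟦ m ⟧)) ⟦ T ⟧) (*-congʳ (eval-falling m))) (⟦⟧-* f m) ⟩
      ⟦ f ⟧ * eval (t+ (a - ⟦ m ⟧)) ⟦ T ⟧ + ⟦ f ⟧ * ⟦ m ⟧
        ≈⟨ distribˡ ⟦ f ⟧ _ _ ⟨
      ⟦ f ⟧ * (eval (t+ (a - ⟦ m ⟧)) ⟦ T ⟧ + ⟦ m ⟧)
        ≈⟨ *-congˡ (eval-linear m) ⟩
      ⟦ f ⟧ * ⟦ N ⟧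
        ≈⟨ ⟦⟧-* f N ⟨
      ⟦ f ℕ.* N ⟧
        ≈⟨ ⟦⟧-cong (falling N m) ⟨
      ⟦ suc m ! ℕ.* (N C suc m) ℕ.+ f ℕ.* m ⟧
        ≈⟨ ⟦⟧-+ (suc m ! ℕ.* (N C suc m)) (f ℕ.* m) ⟩
      ⟦ suc m ! ℕ.* (N C suc m) ⟧ + ⟦ f ℕ.* m ⟧ ∎)
      where
      f = m ! ℕ.* (N C m)
      P = ∏[1… m ] λ i → t+ (a - ⟦ i ∸ 1 ⟧)

    eval-binomial : ∀ m → eval (binomial a m) ⟦ T ⟧ ≈ ⟦ N C m ⟧
    eval-binomial m = begin
      eval (binomial a m) ⟦ T ⟧
        ≈⟨ eval-scale (m !⁻¹) (∏[1… m ] λ i → t+ (a - ⟦ i ∸ 1 ⟧)) ⟦ T ⟧ ⟩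
      m !⁻¹ * eval (∏[1… m ] λ i → t+ (a - ⟦ i ∸ 1 ⟧)) ⟦ T ⟧
        ≈⟨ *-congˡ (trans (eval-falling m) (⟦⟧-* (m !) (N C m))) ⟩
      m !⁻¹ * (⟦ m ! ⟧ * ⟦ N C m ⟧)
        ≈⟨ *-assoc _ _ _ ⟨
      m !⁻¹ * ⟦ m ! ⟧ * ⟦ N C m ⟧
        ≈⟨ *-congʳ (trans (*-comm _ _) (proj₂ (inverse ⟦ m ! ⟧ (char0 (m !) {{m ℕ.!≢0}})))) ⟩
      1# * ⟦ N C m ⟧
        ≈⟨ *-identityˡ _ ⟩
      ⟦ N C m ⟧ ∎

  eval-binomial-0 : ∀ T m → eval (binomial 0# m) ⟦ T ⟧ ≈ ⟦ T C m ⟧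
  eval-binomial-0 T = eval-binomial 0# T T (+-identityʳ ⟦ T ⟧)

  -- `e` is the natural number behind the scalar `⟦ x ⟧ - ⟦ y ⟧`; in `eval-weight` it is the number
  -- of mergeable indices, by `max-u₀`.
  eval-binomial-∸ : ∀ T {x y e} → y ℕ.+ e ≡ x → ∀ m →
                    eval (binomial (⟦ x ⟧ - ⟦ y ⟧) m) ⟦ T ⟧ ≈ ⟦ (T ℕ.+ e) C m ⟧
  eval-binomial-∸ T {x} {y} {e} eq = eval-binomial (⟦ x ⟧ - ⟦ y ⟧) T (T ℕ.+ e) (begin
    ⟦ T ⟧ + (⟦ x ⟧ - ⟦ y ⟧)          ≈⟨ +-congˡ (+-congʳ (trans (⟦⟧-cong (≡.sym eq)) (⟦⟧-+ y e))) ⟩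
    ⟦ T ⟧ + (⟦ y ⟧ + ⟦ e ⟧ - ⟦ y ⟧)  ≈⟨ solve 4 (λ T y n e →
      T :+ (y :+ e :+ n) := T :+ e :+ (y :+ n)) refl ⟦ T ⟧ ⟦ y ⟧ (- ⟦ y ⟧) ⟦ e ⟧ ⟩
    ⟦ T ⟧ + ⟦ e ⟧ + (⟦ y ⟧ - ⟦ y ⟧)  ≈⟨ trans (+-congˡ (-‿inverseʳ ⟦ y ⟧)) (+-identityʳ _) ⟩
    ⟦ T ⟧ + ⟦ e ⟧                    ≈⟨ ⟦⟧-+ T e ⟨
    ⟦ T ℕ.+ e ⟧                      ∎)

  -- Comparison of the coefficients of the two sides.

  eval-coefficient-∷ : ∀ {n} a (u : PackedWord n) x w y →
                       eval (coefficient ((a , u) ∷ x) w) y ≈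
                       ⟦ ind (word u ≟ʷ word w) ⟧ * eval a y + eval (coefficient x w) y
  eval-coefficient-∷ a u x w y with Vec.≡-dec ℕ._≟_ (word u) (word w)
  ... | yes _ = trans (eval-+ᴾ a _ y)
    (+-congʳ (sym (trans (*-congʳ (+-identityʳ 1#)) (*-identityˡ _))))
  ... | no _  = sym (trans (+-congʳ (zeroˡ _)) (+-identityˡ _))

  -- The common form of both sides of the theorem, reached on the right by `∑-N` and on the left by
  -- `∑-N` and `N⋆map⋆N`.
  eval-coefficient-map : ∀ {n} {A : Set} (a : A → K[t]) (π : A → PackedWord n) (F : A → ℕ) y w →
    (∀ x → eval (a x) y ≈ ⟦ F x ⟧) → ∀ xs →
    eval (coefficient (List.map (λ x → a x , π x) xs) w) y ≈
    ⟦ Sum xs (λ x → ind (word (π x) ≟ʷ word w) ℕ.* F x) ⟧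
  eval-coefficient-map a π F y w eq []       = refl
  eval-coefficient-map a π F y w eq (x ∷ xs) = begin
    eval (coefficient ((a x , π x) ∷ List.map (λ x → a x , π x) xs) w) y
      ≈⟨ eval-coefficient-∷ (a x) (π x) _ w y ⟩
    ⟦ i ⟧ * eval (a x) y + eval (coefficient (List.map (λ x → a x , π x) xs) w) y
      ≈⟨ +-cong (trans (*-congˡ (eq x)) (sym (⟦⟧-* i (F x)))) (eval-coefficient-map a π F y w eq xs) ⟩
    ⟦ i ℕ.* F x ⟧ + ⟦ Sum xs (λ x → ind (word (π x) ≟ʷ word w) ℕ.* F x) ⟧
      ≈⟨ ⟦⟧-+ (i ℕ.* F x) _ ⟨
    ⟦ i ℕ.* F x ℕ.+ Sum xs (λ x → ind (word (π x) ≟ʷ word w) ℕ.* F x) ⟧ ∎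
    where i = ind (word (π x) ≟ʷ word w)

  ∑-N : ∀ {n} {A : Set} (a : A → K[t]) (π : A → PackedWord n) xs →
        ∑ xs (λ x → a x • N (π x)) ≡ List.map (λ x → (a x *ᴾ 1ᴾ) , π x) xs
  ∑-N a π []       = ≡.refl
  ∑-N a π (x ∷ xs) = ≡.cong (_ ∷_) (∑-N a π xs)

  N⋆map⋆N : ∀ {n} {A : Set} (u v : PackedWord n) (a : A → K[t]) (π : A → PackedWord n) xs →
            N u ⋆ List.map (λ x → a x , π x) xs ⋆ N v ≡
            List.map (λ x → (1ᴾ *ᴾ a x) *ᴾ 1ᴾ , packBiword (packBiword u (π x)) v) xs
  N⋆map⋆N u v a π []       = ≡.refl
  N⋆map⋆N u v a π (x ∷ xs) = ≡.cong (_ ∷_) (N⋆map⋆N u v a π xs)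

  eval-*1 : ∀ p x → eval (p *ᴾ 1ᴾ) x ≈ eval p x
  eval-*1 p x = trans (eval-*ᴾ p 1ᴾ x) (trans (*-congˡ (eval-1ᴾ x)) (*-identityʳ _))

  eval-1* : ∀ p x → eval (1ᴾ *ᴾ p) x ≈ eval p x
  eval-1* p x = trans (eval-*ᴾ 1ᴾ p x) (trans (*-congʳ (eval-1ᴾ x)) (*-identityˡ _))

  module _ {n} (u v : PackedWord n) where

    weight : PackedWord n → K[t]
    weight w = ∏[1… max (word u) ] (λ i →
      binomial (⟦ max (word (w ∣[ u ] i)) ⟧ - ⟦ a₀ (v ∣[ u ] i) (w ∣[ u ] i) ⟧)
               (max (word (w ∣[ u ] i))))

    eval-weight : ∀ T w → eval (weight w) ⟦ T ⟧ ≈ ⟦ weightAt u v w T ⟧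
    eval-weight T w = eval-∏ (max (word u)) _ _ ⟦ T ⟧ λ i → eval-binomial-∸ T
      (max-u₀ (word (v ∣[ u ] i)) (word (w ∣[ u ] i)) (packed (w ∣[ u ] i))) (blockLength u v w i)

    eval-lhs : ∀ T w → eval (coefficient (N u ⋆ σ₁ᵗ n ⋆ N v) w) ⟦ T ⟧ ≈
               ⟦ Sum (packedWords n) (λ x → ind (word (packBiword (packBiword u x) v) ≟ʷ word w) ℕ.*
                                            (T C max (word x))) ⟧
    eval-lhs T w = trans (reflexive (≡.cong (λ X → eval (coefficient X w) ⟦ T ⟧)
        (≡.trans (≡.cong (λ σ → N u ⋆ σ ⋆ N v) (∑-N β id (packedWords n)))
                 (N⋆map⋆N u v (λ x → β x *ᴾ 1ᴾ) id (packedWords n)))))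
      (eval-coefficient-map _ _ (λ x → T C max (word x)) ⟦ T ⟧ w eval-term (packedWords n))
      where
      β : PackedWord n → K[t]
      β x = binomial 0# (max (word x))
      eval-term : ∀ x → eval ((1ᴾ *ᴾ (β x *ᴾ 1ᴾ)) *ᴾ 1ᴾ) ⟦ T ⟧ ≈ ⟦ T C max (word x) ⟧
      eval-term x = begin
        eval ((1ᴾ *ᴾ (β x *ᴾ 1ᴾ)) *ᴾ 1ᴾ) ⟦ T ⟧  ≈⟨ eval-*1 (1ᴾ *ᴾ (β x *ᴾ 1ᴾ)) ⟦ T ⟧ ⟩
        eval (1ᴾ *ᴾ (β x *ᴾ 1ᴾ)) ⟦ T ⟧          ≈⟨ eval-1* (β x *ᴾ 1ᴾ) ⟦ T ⟧ ⟩
        eval (β x *ᴾ 1ᴾ) ⟦ T ⟧                  ≈⟨ eval-*1 (β x) ⟦ T ⟧ ⟩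
        eval (β x) ⟦ T ⟧                        ≈⟨ eval-binomial-0 T (max (word x)) ⟩
        ⟦ T C max (word x) ⟧                    ∎

    eval-rhs : ∀ T w → eval (coefficient (∑ (W u v) λ x → weight x • N x) w) ⟦ T ⟧ ≈
               ⟦ ind (inW? u v w) ℕ.* weightAt u v w T ⟧
    eval-rhs T w = trans (reflexive (≡.cong (λ X → eval (coefficient X w) ⟦ T ⟧) (∑-N weight id (W u v))))
      (trans (eval-coefficient-map _ id (λ x → weightAt u v x T) ⟦ T ⟧ w
               (λ x → trans (eval-*1 (weight x) ⟦ T ⟧) (eval-weight T x)) (W u v))
             (⟦⟧-cong (Sum-W u v w T)))

mainTheorem5 :
    ∀ {c ℓ} (K : Field c ℓ) (char0 : CharacteristicZero K) →
    let open Field K using (_-_)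
        open Field K using (⟦_⟧)
        open WQSym K char0
    in ∀ {n : ℕ} (u v : PackedWord n) →
      N u ⋆ σ₁ᵗ n ⋆ N v
        ≋ ∑ (W u v) (λ w →
            ∏[1… max (word u) ] (λ i →
              binomial (⟦ max (word (w ∣[ u ] i)) ⟧ - ⟦ a₀ (v ∣[ u ] i) (w ∣[ u ] i) ⟧)
                       (max (word (w ∣[ u ] i))))
            • N w)
mainTheorem5 K char0 {n} u v w = interpolation K char0
  (coefficient (N u ⋆ σ₁ᵗ n ⋆ N v) w) (coefficient (∑ (W u v) λ x → weight K char0 u v x • N x) w) λ T →
  trans (eval-lhs K char0 u v T w)
    (trans (⟦⟧-cong K char0 (packBiword-count u v w T)) (sym (eval-rhs K char0 u v T w)))
  where
  open Field K using (trans; sym)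
  open WQSym K char0
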